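{- Let $G$ be a finite, simple, connected graph on $n$ vertices with $m \le 2n-1$ edges and maximum degree $\Delta(G) \le 4$. Then $a'(G) \le 6$.
   Context: A proper edge coloring of a graph assigns colors to edges so that adjacent edges (edges sharing an endpoint) receive different colors. It is acyclic if there is no bichromatic cycle, i.e. no cycle whose edges use only two colors. The acyclic chromatic index $a'(G)$ is the minimum number of colors in an acyclic edge coloring of $G$. -}

module Defs where

open import Data.Fin using (Fin)
open import Data.Fin.Properties using (_<?_)
open import Data.List using (List; []; _∷_; length; filter; map; allFin; cartesianProduct)
open import Data.List.Extrema.Nat using (max)
open import Data.List.Relation.Unary.All using (All)
open import Data.List.Relation.Unary.Unique.Propositional using (Unique)
open import Data.Nat using (ℕ; _≤_)
open import Data.Product using (Σ; _×_; _,_)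
open import Data.Sum using (_⊎_)
open import Level using (0ℓ)
open import Relation.Binary.Construct.Closure.ReflexiveTransitive using (Star; ε; _◅_)
open import Relation.Binary.Core using (Rel)
open import Relation.Binary.Definitions using (Decidable; Symmetric; Irreflexive)
open import Relation.Binary.PropositionalEquality using (_≡_; _≢_)
open import Relation.Nullary using (¬_)
open import Relation.Nullary.Decidable using (_×-dec_)

record SimpleGraph (n : ℕ) : Set₁ where
  field
    Adj        : Rel (Fin n) 0ℓ
    adj?       : Decidable Adj
    adj-sym    : Symmetric Adj
    adj-irrefl : Irreflexive _≡_ Adj

module _ {n : ℕ} (G : SimpleGraph n) where
  open SimpleGraph G

  -- Each edge is listed once, by its increasing pair of endpoints.
  edges : List (Fin n × Fin n)
  edges = filter (λ (u , v) → (u <? v) ×-dec adj? u v)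
                 (cartesianProduct (allFin n) (allFin n))

  size : ℕ
  size = length edges

  degree : Fin n → ℕ
  degree v = length (filter (adj? v) (allFin n))

  Δ : ℕ
  Δ = max 0 (map degree (allFin n))

  Walk : Fin n → Fin n → Set
  Walk = Star Adj

  -- The graph with no vertices does not count as connected.
  Connected : Set
  Connected = Fin n × (∀ u v → Walk u v)

  -- The vertices of a walk in order, without its final vertex.
  vertices : ∀ {u v} → Walk u v → List (Fin n)
  vertices ε                 = []
  vertices (_◅_ {i = u} _ p) = u ∷ vertices p

  -- For a closed walk, the omitted final vertex is the first one, so
  -- vertices p lists every visited vertex and its length is the number
  -- of edges of p.
  IsCycle : ∀ {v} → Walk v v → Set
  IsCycle p = 3 ≤ length (vertices p) × Unique (vertices p)

  -- An edge is an unordered pair of vertices: colour-sym makes the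
  -- colour independent of the orientation, and (applying it twice) of
  -- the chosen proof of adjacency.
  record EdgeColouring (k : ℕ) : Set where
    field
      colour     : ∀ u v → Adj u v → Fin k
      colour-sym : ∀ u v (e : Adj u v) (f : Adj v u) → colour u v e ≡ colour v u f

  module _ {k : ℕ} (c : EdgeColouring k) where
    open EdgeColouring c

    Proper : Set
    Proper = ∀ u v w (e : Adj u v) (f : Adj u w) → v ≢ w → colour u v e ≢ colour u w f

    colours : ∀ {u v} → Walk u v → List (Fin k)
    colours ε                         = []
    colours (_◅_ {i = u} {j = v} e p) = colour u v e ∷ colours p

    Bichromatic : ∀ {u v} → Walk u v → Set
    Bichromatic p = Σ (Fin k) λ a → Σ (Fin k) λ b → All (λ x → x ≡ a ⊎ x ≡ b) (colours p)

    Acyclic : Set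
    Acyclic = ∀ v (p : Walk v v) → IsCycle p → ¬ Bichromatic p

  AcyclicEdgeColourable : ℕ → Set
  AcyclicEdgeColourable k = Σ (EdgeColouring k) λ c → Proper c × Acyclic c

  IsAcyclicChromaticIndex : ℕ → Set
  IsAcyclicChromaticIndex a =
    AcyclicEdgeColourable a × (∀ k → AcyclicEdgeColourable k → a ≤ k)

{-# OPTIONS --safe #-}
-- Since G is connected, has maximum degree at most 4 and is not 4-regular,
-- its vertices can be deleted one by one so that each has at most three
-- neighbours left when it is deleted.  Undo the deletions.  When x returns,
-- each of its neighbours y, z, w misses at least three of the six colours.
-- If any two of the three sets of missing colours meet, colours for x y,
-- x z, x w can be chosen so that no bichromatic cycle can arise.  Otherwise,
-- say, y and z have no missing colour in common.  Then either some choice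
-- works, or so many bichromatic walks join the neighbours of x that at y
-- (or z) there are two edges whose far ends see all colours missing there.
-- Exchanging the colours of these two edges creates no bichromatic cycle and
-- cuts the walk that obstructs some choice.
module Submission where

open import Defs
open import Data.Empty using (⊥; ⊥-elim)
open import Data.Fin using (Fin; zero; suc; toℕ; fromℕ<; funToFin; finToFun)
import Data.Fin.Properties as Fin
open import Data.List using (List; []; _∷_; _++_; length; filter; allFin; map; cartesianProduct)
open import Data.List.Extrema.Nat using (xs≤max)
open import Data.List.Membership.Propositional using (_∈_; _∉_)
open import Data.List.Membership.Propositional.Properties using (∈-∃++; ∈-++⁺ˡ; ∈-++⁺ʳ; ∈-++⁻; ∈-allFin; ∈-filter⁺; ∈-filter⁻; ∈-map⁺; ∈-cartesianProduct⁺)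
open import Data.List.Properties using (length-++; length-tabulate; length-map; filter-++)
open import Data.List.Relation.Binary.Subset.Propositional using (_⊆_)
open import Data.List.Relation.Unary.All as All using (All; []; _∷_)
open import Data.List.Relation.Unary.All.Properties using (all-filter; ¬Any⇒All¬)
open import Data.List.Relation.Unary.AllPairs using ([]; _∷_)
open import Data.List.Relation.Unary.Any using (here; there)
open import Data.List.Relation.Unary.Unique.Propositional using (Unique)
open import Data.List.Relation.Unary.Unique.Propositional.Properties using (allFin⁺; filter⁺; cartesianProduct⁺)
open import Data.Maybe using (Maybe; just; nothing)
open import Data.Maybe.Properties using (just-injective)
open import Data.Nat using (ℕ; zero; suc; _+_; _*_; _∸_; _^_; _≤_; _<_; s≤s; z≤n; _≤?_)
import Data.Nat.Properties as ℕ
open import Data.Product using (Σ; ∃; ∃-syntax; _×_; _,_; proj₁; proj₂; swap)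
import Data.Sum as Sum
open import Data.Sum using (_⊎_; inj₁; inj₂; [_,_]′)
open import Data.Sum.Properties using (≡-dec; inj₁-injective)
open import Data.Unit using (⊤)
open import Effect.Monad using (RawMonad)
open import Function using (_∘_; id)
import Relation.Binary.Construct.Closure.ReflexiveTransitive as Star
open import Relation.Binary.Construct.Closure.ReflexiveTransitive using (Star; ε; _◅_; _◅◅_)
open import Relation.Binary.Definitions using (DecidableEquality; tri<; tri≈; tri>)
open import Relation.Binary.PropositionalEquality using (_≡_; _≢_; refl; sym; trans; cong; cong₂; subst; subst₂; ≢-sym)
open import Relation.Nullary using (¬_; Dec; yes; no; contradiction)
open import Relation.Nullary.Decidable using (¬?; _×-dec_; _⊎-dec_; _→-dec_; map′; ¬¬-excluded-middle)
open import Relation.Nullary.Negation using (¬¬-Monad)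
open import Relation.Unary using (Decidable)

-- The numbers fit exactly. If y and z have no missing colour in common, their missing colours
-- exhaust the six, so two of the three missing at w lie on the same side. In the exchange, a far
-- end has at most four coloured edges: one is its edge to the centre, the other three carry colours
-- missing at the centre. Without the first it shares no colour with the centre, so no new
-- bichromatic cycle can pass through it.
--
-- Colours for x y and x z clash only if a walk alternating between them joins y to z. Such a walk
-- is determined by its first state, so a walk leaving z in two given colours has a single end: it
-- cannot obstruct both y and w, and cutting it removes the obstruction.
--
-- Whether a walk obstructs is not decided for an arbitrary colouring. Existence is therefore proved
-- doubly negated, which permits case distinctions on obstructions; the negations disappear at the
-- end, where colourability with a given number of colours is decided by a finite search. The same
-- search supplies the minimum.

-- Alternating walks

-- A partial edge colouring of the complete graph on V; nothing marks a non-edge.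
Colouring : Set → Set → Set
Colouring V K = V → V → Maybe K

-- A state (v , a , b) is a vertex together with the colour a of the next
-- edge to follow and the colour b of the one after it.  Walks through
-- states are thus alternating walks, and an a/b-bichromatic cycle is a
-- closed one.
State : Set → Set → Set
State V K = V × K × K

module _ {V K : Set} where

  flip : State V K → State V K
  flip (v , a , b) = v , b , a

  data Step (C : Colouring V K) : State V K → State V K → Set where
    along : ∀ {u v a b} → C u v ≡ just a → Step C (u , a , b) (v , b , a)

  Alternating : Colouring V K → State V K → State V K → Set
  Alternating C = Star (Step C)

  Sees : Colouring V K → V → K → Set
  Sees C v a = ∃[ u ] C v u ≡ just a

  -- Counting through duplicate-free lists makes sense even where `Sees` is not known to be
  -- decidable.
  AtMost : ℕ → Colouring V K → V → Set
  AtMost k C v = ∀ cs → Unique cs → All (Sees C v) cs → length cs ≤ k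

  -- With `a ≢ b` a step cannot retrace the edge just used, so in a proper colouring a nonempty
  -- closed walk of states goes round a bichromatic cycle. This is why `acyclic` can speak of walks
  -- and say nothing about distinct vertices.
  record Good (C : Colouring V K) : Set where
    field
      symmetric   : ∀ {u v a} → C u v ≡ just a → C v u ≡ just a
      irreflexive : ∀ {u a} → C u u ≢ just a
      proper      : ∀ {u v w a} → C u v ≡ just a → C u w ≡ just a → v ≡ w
      acyclic     : ∀ {u a b q} → a ≢ b → Step C (u , a , b) q → ¬ Alternating C q (u , a , b)

  infix 4 _⊑_
  _⊑_ : Colouring V K → Colouring V K → Set
  C ⊑ D = ∀ {u v a} → C u v ≡ just a → D u v ≡ just a

  step-mono : ∀ {C D} → C ⊑ D → ∀ {p q} → Step C p q → Step D p q
  step-mono C⊑D (along e) = along (C⊑D e)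

  alternating-mono : ∀ {C D} → C ⊑ D → ∀ {p q} → Alternating C p q → Alternating D p q
  alternating-mono C⊑D = Star.map (step-mono C⊑D)

  good-antimono : ∀ {C D} → C ⊑ D → (∀ {u v a} → C u v ≡ just a → C v u ≡ just a) →
                  Good D → Good C
  good-antimono C⊑D C-sym good = record
    { symmetric   = C-sym
    ; irreflexive = λ e → irreflexive (C⊑D e)
    ; proper      = λ e f → proper (C⊑D e) (C⊑D f)
    ; acyclic     = λ a≢b s w → acyclic a≢b (step-mono C⊑D s) (alternating-mono C⊑D w)
    } where open Good good

  alternating-colours : ∀ {C u v a b c d} → Alternating C (u , a , b) (v , c , d) →
                        (c ≡ a × d ≡ b) ⊎ (c ≡ b × d ≡ a)
  alternating-colours ε = inj₁ (refl , refl)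
  alternating-colours (along _ ◅ w) with alternating-colours w
  ... | inj₁ eqs = inj₂ eqs
  ... | inj₂ eqs = inj₁ eqs

  first-step : ∀ {C p q} → Alternating C p q → p ≢ q → ∃[ r ] Step C p r × Alternating C r q
  first-step ε       p≢q = contradiction refl p≢q
  first-step (s ◅ w) _   = _ , s , w

  module _ {C : Colouring V K} (good : Good C) where
    open Good good

    deterministic : ∀ {p q r} → Step C p q → Step C p r → q ≡ r
    deterministic (along e) (along f) = cong (_, _) (proper e f)

    step-reverse : ∀ {p q} → Step C p q → Step C (flip q) (flip p)
    step-reverse (along e) = along (symmetric e)

    alternating-reverse : ∀ {p q} → Alternating C p q → Alternating C (flip q) (flip p)
    alternating-reverse ε       = ε
    alternating-reverse (s ◅ w) = alternating-reverse w ◅◅ (step-reverse s ◅ ε)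

    Stuck : State V K → Set
    Stuck p = ∀ {q} → ¬ Step C p q

    -- By determinism, one walk is an initial part of the other. It is used to show that a walk
    -- ending at one vertex does not end at another.
    stuck-unique : ∀ {p q r} → Alternating C p q → Stuck q → Alternating C p r → Stuck r → q ≡ r
    stuck-unique ε        _  ε        _  = refl
    stuck-unique ε        sq (s ◅ _)  _  = contradiction s sq
    stuck-unique (s ◅ _)  _  ε        sr = contradiction s sr
    stuck-unique (s ◅ w)  sq (s′ ◅ w′) sr with refl ← deterministic s s′ = stuck-unique w sq w′ sr

    unseen⇒stuck : ∀ {v a b} → ¬ Sees C v a → Stuck (v , a , b)
    unseen⇒stuck ¬seen (along e) = ¬seen (_ , e)

    -- A closed walk of odd length would be a palindrome, and so could be
    -- continued for ever; going round twice closes it up.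
    no-odd-closed : ∀ {u a b} → a ≢ b → ¬ Alternating C (u , a , b) (u , b , a)
    no-odd-closed {u} {a} {b} a≢b w =
      let _ , s , w′ = first-step w λ { refl → a≢b refl } in
      acyclic a≢b s (w′ ◅◅ follow w a≢b w)
      where
      -- The odd walk and its reverse start in the same state, so its first and last edges coincide.
      -- They are not one single traversal, as there are no loops; cutting both off leaves an odd
      -- closed walk at the next vertex.
      follow : ∀ {v c d q} → Alternating C (v , c , d) q → c ≢ d →
               Alternating C (v , c , d) (v , d , c) → Alternating C q (flip q)
      follow ε             _   w = w
      follow (along e ◅ p) c≢d w
        with first-step w (λ { refl → c≢d refl })
      ... | _ , along e′ , w₁ with refl ← proper e e′
        with first-step (alternating-reverse w₁) (λ { refl → irreflexive e })
      ...   | _ , s , w₂ with refl ← deterministic (along e) s = follow p (≢-sym c≢d) w₂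

    -- The colour a is blocked for u against b for v: colouring two edges
    -- x u and x v by a and b closes a cycle.
    Critical : V → K → V → K → Set
    Critical u a v b = Alternating C (u , b , a) (v , b , a)

    critical-sym : ∀ {u a v b} → Critical u a v b → Critical v b u a
    critical-sym = alternating-reverse

    -- The neighbour `t` depends only on `u` and `b`: if `b` is critical against several colours
    -- `a`, one `t` sees them all.
    critical-start : ∀ {u a v b} → u ≢ v → a ≢ b → Critical u a v b →
                     ∃[ t ] C u t ≡ just b × Sees C t a
    critical-start u≢v a≢b w with first-step w (λ { refl → u≢v refl })
    ... | t , along e , w′ with first-step w′ (λ { refl → a≢b refl })
    ...   | _ , along f , _ = _ , e , _ , f

    critical-seen : ∀ {u a v b} → u ≢ v → Critical u a v b → Sees C u b
    critical-seen u≢v w with first-step w (λ { refl → u≢v refl })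
    ... | _ , along e , _ = _ , e

    -- The cheap way to exclude a critical walk: one end misses the colour of the other. Where
    -- enough colours are missed in common, it handles every pair.
    missed₁ : ∀ {u v a b} → u ≢ v → ¬ Sees C u b → ¬ Critical u a v b
    missed₁ u≢v ¬seen = ¬seen ∘ critical-seen u≢v

    missed₂ : ∀ {u v a b} → u ≢ v → ¬ Sees C v a → ¬ Critical u a v b
    missed₂ u≢v ¬seen = missed₁ (≢-sym u≢v) ¬seen ∘ critical-sym

-- Recolouring all edges at one vertex

module _ {V K : Set} (_≟_ : DecidableEquality V) where

  attach : Colouring V K → V → (V → Maybe K) → Colouring V K
  attach C x f u v with u ≟ x | v ≟ x
  ... | yes _ | _     = f v
  ... | no _  | yes _ = f u
  ... | no _  | no _  = C u v

  detach : Colouring V K → V → Colouring V K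
  detach C x = attach C x (λ _ → nothing)

  module _ (C : Colouring V K) (x : V) (f : V → Maybe K) where

    attach-at : ∀ v → attach C x f x v ≡ f v
    attach-at v with x ≟ x | v ≟ x
    ... | yes _   | _ = refl
    ... | no x≢x  | _ = contradiction refl x≢x

    attach-to : ∀ {u} → u ≢ x → attach C x f u x ≡ f u
    attach-to {u} u≢x with u ≟ x | x ≟ x
    ... | yes u≡x | _       = contradiction u≡x u≢x
    ... | no _    | yes _   = refl
    ... | no _    | no x≢x  = contradiction refl x≢x

    attach-off : ∀ {u v} → u ≢ x → v ≢ x → attach C x f u v ≡ C u v
    attach-off {u} {v} u≢x v≢x with u ≟ x | v ≟ x
    ... | yes u≡x | _       = contradiction u≡x u≢x
    ... | no _    | yes v≡x = contradiction v≡x v≢x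
    ... | no _    | no _    = refl

    attach-symmetric : (∀ {u v a} → C u v ≡ just a → C v u ≡ just a) →
                       ∀ {u v a} → attach C x f u v ≡ just a → attach C x f v u ≡ just a
    attach-symmetric C-sym {u} {v} e with u ≟ x | v ≟ x
    ... | yes refl | yes refl = e
    ... | yes _    | no _     = e
    ... | no _     | yes _    = e
    ... | no _     | no _     = C-sym e

  detach-⊑ : ∀ {C x} → detach C x ⊑ C
  detach-⊑ {C} {x} {u} {v} e with u ≟ x | v ≟ x
  detach-⊑ () | yes _ | _
  detach-⊑ () | no _  | yes _
  detach-⊑ e  | no _  | no _ = e

  detach-off : ∀ {C x u v a} → detach C x u v ≡ just a → u ≢ x × v ≢ x
  detach-off {x = x} {u} {v} e with u ≟ x | v ≟ x
  detach-off () | yes _ | _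
  detach-off () | no _  | yes _
  detach-off e  | no u≢x  | no v≢x = u≢x , v≢x

  detach-good : ∀ {C} x → Good C → Good (detach C x)
  detach-good {C} x good =
    good-antimono detach-⊑ (attach-symmetric C x (λ _ → nothing) (Good.symmetric good)) good

  module _ {C : Colouring V K} (good : Good C) {x : V} (isolated : ∀ {v a} → C x v ≢ just a)
           {f : V → Maybe K} (fx : f x ≡ nothing)
           (f-injective : ∀ {u v a} → f u ≡ just a → f v ≡ just a → u ≡ v)
           (f-unseen : ∀ {v a} → f v ≡ just a → ¬ Sees C v a)
           (uncritical : ∀ {u v a b} → u ≢ v → f u ≡ just a → f v ≡ just b → ¬ Critical good u a v b)
           where
    open Good good

    private
      C′ : Colouring V K
      C′ = attach C x f

      centre-edge : ∀ {v a} → C′ x v ≡ just a → v ≢ x × f v ≡ just a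
      centre-edge {v} e with trans (sym (attach-at C x f v)) e
      ... | fv = (λ { refl → contradiction (trans (sym fx) fv) λ () }) , fv

      -- Cut a walk at its first visit to x.
      data Run (p q : State V K) : Set where
        avoids : proj₁ q ≢ x → Alternating C p q → Run p q
        enters : ∀ {v a b} → v ≢ x → f v ≡ just a → Alternating C p (v , a , b) →
                 Alternating C′ (x , b , a) q → Run p q

      off-centre-edge : ∀ {u v a} → u ≢ x → C′ u v ≡ just a →
                        (v ≡ x × f u ≡ just a) ⊎ (v ≢ x × C u v ≡ just a)
      off-centre-edge {u} {v} u≢x e with u ≟ x | v ≟ x
      ... | yes u≡x | _       = contradiction u≡x u≢x
      ... | no _    | yes v≡x = inj₁ (v≡x , e)
      ... | no _    | no v≢x  = inj₂ (v≢x , e)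

      run : ∀ {u a b q} → u ≢ x → Alternating C′ (u , a , b) q → Run (u , a , b) q
      run u≢x ε = avoids u≢x ε
      run u≢x (along e ◅ w) with off-centre-edge u≢x e
      ... | inj₁ (refl , fu) = enters u≢x fu ε w
      ... | inj₂ (v≢x , e′) with run v≢x w
      ...   | avoids q≢x w′      = avoids q≢x (along e′ ◅ w′)
      ...   | enters v≢x fv w′ r = enters v≢x fv (along e′ ◅ w′) r

      -- The walk leaves `x` towards a leaf `v` and first returns from a leaf `v′`, staying in `C`
      -- in between. Distinct leaves make that piece a critical walk; equal leaves make it an odd
      -- closed walk.
      acyclic-at-centre : ∀ {a b q} → a ≢ b → Step C′ (x , a , b) q → ¬ Alternating C′ q (x , a , b)
      acyclic-at-centre a≢b (along e) w with centre-edge e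
      ... | v≢x , fv with run v≢x w
      ...   | avoids x≢x _ = x≢x refl
      ...   | enters _ fv′ w′ _ with alternating-colours w′
      ...     | inj₁ (refl , refl) = uncritical v≢v′ fv fv′ w′
        where v≢v′ = λ { refl → a≢b (just-injective (trans (sym fv) fv′)) }
      ...     | inj₂ (refl , refl) with refl ← f-injective fv fv′ =
        no-odd-closed good (≢-sym a≢b) w′

      rotate : ∀ {p q} → Alternating C′ p q → Step C′ q p → ∃[ r ] Step C′ p r × Alternating C′ r p
      rotate ε       s = _ , s , ε
      rotate (t ◅ w) s = _ , t , w ◅◅ (s ◅ ε)

      -- A closed walk avoiding `x` already lies in `C`; any other is rotated to start at `x`.
      acyclic′ : ∀ {u a b q} → a ≢ b → Step C′ (u , a , b) q → ¬ Alternating C′ q (u , a , b)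
      acyclic′ {u} a≢b s w with u ≟ x
      ... | yes refl = acyclic-at-centre a≢b s w
      acyclic′ {u} a≢b s@(along e) w | no u≢x with off-centre-edge u≢x e
      ... | inj₁ (refl , _) = let _ , t , w′ = rotate w s in acyclic-at-centre (≢-sym a≢b) t w′
      ... | inj₂ (v≢x , e′) with run v≢x w
      ...   | avoids _ w′ = acyclic a≢b (along e′) w′
      ...   | enters {v′} v′≢x fv′ w′ r =
        let _ , t , w″ = rotate (r ◅◅ (s ◅ alternating-mono below w′))
                                (along (trans (attach-to C x f v′≢x) fv′))
        in acyclic-at-centre ends t w″
        where
        below : C ⊑ C′
        below {u} {v} e =
          trans (attach-off C x f (λ { refl → isolated e }) (λ { refl → isolated (symmetric e) })) e
        ends = λ b≡a → [ (λ { (refl , refl) → a≢b b≡a }) , (λ { (refl , refl) → a≢b (sym b≡a) }) ]′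
                       (alternating-colours w′)

    attach-good : Good (attach C x f)
    attach-good = record
      { symmetric   = attach-symmetric C x f symmetric
      ; irreflexive = irreflexive′
      ; proper      = proper′
      ; acyclic     = acyclic′
      } where
      irreflexive′ : ∀ {u a} → C′ u u ≢ just a
      irreflexive′ {u} e with u ≟ x
      ... | yes refl = contradiction (trans (sym fx) e) λ ()
      ... | no _     = irreflexive e
      proper′ : ∀ {u v w a} → C′ u v ≡ just a → C′ u w ≡ just a → v ≡ w
      proper′ {u} {v} {w} e g with u ≟ x | v ≟ x | w ≟ x
      ... | yes _ | _        | _        = f-injective e g
      ... | no _  | yes refl | yes refl = refl
      ... | no _  | yes _    | no _     = contradiction (_ , g) (f-unseen e)
      ... | no _  | no _     | yes _    = contradiction (_ , e) (f-unseen g)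
      ... | no _  | no _     | no _     = proper e g

-- Exchanging two colours at a vertex

module _ {V K : Set} (_≟_ : DecidableEquality V) where

  transpose : V → V → V → V
  transpose p q v with v ≟ p | v ≟ q
  ... | yes _ | _     = q
  ... | no _  | yes _ = p
  ... | no _  | no _  = v

  data Transposed (p q v : V) : V → Set where
    first  : v ≡ p → Transposed p q v q
    second : v ≡ q → Transposed p q v p
    other  : v ≢ p → v ≢ q → Transposed p q v v

  transposed : ∀ p q v → Transposed p q v (transpose p q v)
  transposed p q v with v ≟ p | v ≟ q
  ... | yes v≡p | _       = first v≡p
  ... | no _    | yes v≡q = second v≡q
  ... | no v≢p  | no v≢q  = other v≢p v≢q

  transpose-injective : ∀ {p q u v} → transpose p q u ≡ transpose p q v → u ≡ v
  transpose-injective {p} {q} {u} {v} eq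
    with transpose p q u | transposed p q u | transpose p q v | transposed p q v
  ... | _ | first refl    | _ | first refl    = refl
  ... | _ | first refl    | _ | second refl   = sym eq
  ... | _ | first refl    | _ | other _ v≢q   = contradiction (sym eq) v≢q
  ... | _ | second refl   | _ | first refl    = sym eq
  ... | _ | second refl   | _ | second refl   = refl
  ... | _ | second refl   | _ | other v≢p _   = contradiction (sym eq) v≢p
  ... | _ | other _ u≢q   | _ | first refl    = contradiction eq u≢q
  ... | _ | other u≢p _   | _ | second refl   = contradiction eq u≢p
  ... | _ | other _ _     | _ | other _ _     = eq

  -- Exchanging the colours κ and μ of two edges s p and s q is harmless
  -- when p and q see, besides the colours of these edges, only colours βs
  -- that are missing at s.
  module Exchange
    {C : Colouring V K} (good : Good C) {s p q : V} {κ μ : K}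
    (sp : C s p ≡ just κ) (sq : C s q ≡ just μ) (κ≢μ : κ ≢ μ)
    {βs : List K} (βs-unique : Unique βs) (∣βs∣ : length βs ≡ 3)
    (s-misses : All (λ β → ¬ Sees C s β) βs)
    (p-sees : All (Sees C p) βs) (q-sees : All (Sees C q) βs)
    (p≤4 : AtMost 4 C p) (q≤4 : AtMost 4 C q)
    where
    open Good good

    private
      σ : V → V
      σ = transpose p q

      f : V → Maybe K
      f v = C s (σ v)

      C⁻ : Colouring V K
      C⁻ = detach _≟_ C s

      good⁻ : Good C⁻
      good⁻ = detach-good _≟_ s good

      -- `r` sees `ρ` and the three `βs`. A further colour seen at `s` differs from the `βs`, which
      -- `s` misses, and would be a fifth.
      full : ∀ {r ρ c} → C s r ≡ just ρ → All (Sees C r) βs → AtMost 4 C r →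
             Sees C s c → ¬ Sees C⁻ r c
      full {r} {ρ} {c} sr r-sees r≤4 s-sees (u , e) =
        contradiction (r≤4 (c ∷ ρ ∷ βs) ((c≢ρ ∷ differs s-sees) ∷ differs (r , sr) ∷ βs-unique)
                           ((u , e′) ∷ (s , symmetric sr) ∷ r-sees))
                      (subst (λ k → ¬ (2 + k ≤ 4)) (sym ∣βs∣)
                             (λ { (s≤s (s≤s (s≤s (s≤s ())))) }))
        where
        e′ = detach-⊑ _≟_ e
        c≢ρ : c ≢ ρ
        c≢ρ refl = proj₂ (detach-off _≟_ {C} e) (proper e′ (symmetric sr))
        differs : ∀ {d} → Sees C s d → All (d ≢_) βs
        differs d-seen = All.map (λ β-missed d≡β → β-missed (subst (Sees C s) d≡β d-seen)) s-misses

      p-full : ∀ {c} → Sees C s c → ¬ Sees C⁻ p c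
      p-full = full sp p-sees p≤4

      q-full : ∀ {c} → Sees C s c → ¬ Sees C⁻ q c
      q-full = full sq q-sees q≤4

      p≢s : p ≢ s
      p≢s refl = irreflexive sp

      q≢s : q ≢ s
      q≢s refl = irreflexive sq

      σs : σ s ≡ s
      σs with σ s | transposed p q s
      ... | _ | first s≡p  = contradiction (sym s≡p) p≢s
      ... | _ | second s≡q = contradiction (sym s≡q) q≢s
      ... | _ | other _ _  = refl

      fs : f s ≡ nothing
      fs rewrite σs with C s s in eq
      ... | nothing = refl
      ... | just _  = contradiction eq irreflexive

      σp : σ p ≡ q
      σp with σ p | transposed p q p
      ... | _ | first _     = refl
      ... | _ | second p≡q  = p≡q
      ... | _ | other p≢p _ = contradiction refl p≢p

      f-unseen : ∀ {v a} → f v ≡ just a → ¬ Sees C⁻ v a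
      f-unseen {v} fv with σ v | transposed p q v
      ... | _ | first refl  = p-full (_ , fv)
      ... | _ | second refl = q-full (_ , fv)
      ... | _ | other _ _   = λ (u , e) →
        proj₂ (detach-off _≟_ {C} e) (proper (detach-⊑ _≟_ e) (symmetric fv))

      -- A critical walk ending at `p` or `q` would start there with a colour seen at `s`, against
      -- `full`. Between two other neighbours it would close up through `s` to a cycle of `C`.
      uncritical : ∀ {u v a b} → u ≢ v → f u ≡ just a → f v ≡ just b → ¬ Critical good⁻ u a v b
      uncritical {u} {v} u≢v fu fv w = cases (transposed p q u) (transposed p q v) fu fv
        where
        u-sees = critical-seen good⁻ u≢v w
        v-sees = critical-seen good⁻ (≢-sym u≢v) (critical-sym good⁻ w)
        a≢b = λ { refl → u≢v (transpose-injective (proper fu fv)) }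
        cases : ∀ {u′ v′} → Transposed p q u u′ → Transposed p q v v′ →
                C s u′ ≡ just _ → C s v′ ≡ just _ → ⊥
        cases (first refl)  _             _ _ = p-full (_ , fv) u-sees
        cases (second refl) _             _ _ = q-full (_ , fv) u-sees
        cases (other _ _)   (first refl)  _ _ = p-full (_ , fu) v-sees
        cases (other _ _)   (second refl) _ _ = q-full (_ , fu) v-sees
        cases (other _ _)   (other _ _)   e g =
          acyclic a≢b (along e)
            (alternating-mono (detach-⊑ _≟_) w ◅◅ (along (symmetric g) ◅ ε))

    exchange : Colouring V K
    exchange = attach _≟_ C⁻ s f

    exchange-good : Good exchange
    exchange-good = attach-good _≟_ good⁻ (λ e → proj₁ (detach-off _≟_ {C} e) refl) fs
      (λ e g → transpose-injective (proper e g)) f-unseen uncritical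

    private
      exchange-off : ∀ {u v} → u ≢ s → v ≢ s → exchange u v ≡ C u v
      exchange-off u≢s v≢s = trans (attach-off _≟_ C⁻ s f u≢s v≢s) (attach-off _≟_ C s _ u≢s v≢s)

      exchange-to : ∀ {u} → u ≢ s → exchange u s ≡ f u
      exchange-to = attach-to _≟_ C⁻ s f

    exchange-support : ∀ {u v a} → C u v ≡ just a → ∃[ b ] exchange u v ≡ just b
    exchange-support {u} {v} e = go (u ≟ s) (v ≟ s)
      where
      star : ∀ {v a} → C s v ≡ just a → ∃[ b ] f v ≡ just b
      star {v} e with σ v | transposed p q v
      ... | _ | first _   = _ , sq
      ... | _ | second _  = _ , sp
      ... | _ | other _ _ = _ , e
      go : Dec (u ≡ s) → Dec (v ≡ s) → ∃[ b ] exchange u v ≡ just b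
      go (yes refl) _          = _ , trans (attach-at _≟_ C⁻ s f v) (proj₂ (star e))
      go (no u≢s)   (yes refl) = _ , trans (exchange-to u≢s) (proj₂ (star (symmetric e)))
      go (no u≢s)   (no v≢s)   = _ , trans (exchange-off u≢s v≢s) e

    exchange-sees : ∀ {v c} → v ≢ p → v ≢ q → Sees exchange v c → Sees C v c
    exchange-sees {v} {c} v≢p v≢q (u , e) = go (v ≟ s) (u ≟ s)
      where
      go : Dec (v ≡ s) → Dec (u ≡ s) → Sees C v c
      go (yes refl) _ = σ u , trans (sym (attach-at _≟_ C⁻ s f u)) e
      go (no v≢s) (yes refl) with σ v | transposed p q v | trans (sym (exchange-to v≢s)) e
      ... | _ | first v≡p  | _ = contradiction v≡p v≢p
      ... | _ | second v≡q | _ = contradiction v≡q v≢q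
      ... | _ | other _ _  | g = _ , symmetric g
      go (no v≢s) (no u≢s) = u , trans (sym (exchange-off v≢s u≢s)) e

    exchange-sees-centre : ∀ {c} → Sees exchange s c → Sees C s c
    exchange-sees-centre = exchange-sees (≢-sym p≢s) (≢-sym q≢s)

    -- A walk that used to reach s through the edge s p now ends at p, and
    -- its start has lost its critical walks.
    exchange-uncritical : ∀ {t β} → t ≢ s → ¬ Sees C s β → Critical good t κ s β →
                          ∀ {v} → ¬ Sees exchange v β → ¬ Critical exchange-good t κ v β
    exchange-uncritical {t} {β} t≢s β-missed w ¬seen w′
      with stuck-unique exchange-good (truncate t≢s w) p-stuck w′ (unseen⇒stuck exchange-good ¬seen)
      where
      truncate : ∀ {u c d} → u ≢ s → Alternating C (u , c , d) (s , β , κ) →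
                 Alternating exchange (u , c , d) (p , κ , β)
      truncate u≢s ε = contradiction refl u≢s
      truncate u≢s (along {v = v} e ◅ w) = go (v ≟ s)
        where
        go : Dec (v ≡ s) → Alternating exchange _ (p , κ , β)
        go (no v≢s) = along (trans (exchange-off u≢s v≢s) e) ◅ truncate v≢s w
        go (yes refl) with alternating-colours w
        ... | inj₁ (refl , refl) with refl ← proper sp (symmetric e) = ε
        ... | inj₂ (refl , refl) = contradiction (_ , symmetric e) β-missed
      p-stuck : Stuck exchange-good (p , κ , β)
      p-stuck (along {v = v} e) = go (v ≟ s)
        where
        go : Dec (v ≡ s) → ⊥
        go (yes refl) = κ≢μ (just-injective
          (trans (sym (trans (sym (exchange-to p≢s)) e)) (trans (cong (C s) σp) sq)))
        go (no v≢s) = v≢s (proper (trans (sym (exchange-off p≢s v≢s)) e) (symmetric sp))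
    -- Both walks are maximal from the same state, so their ends agree. This forces `β` to be `κ`,
    -- which `s` sees.
    ... | refl = β-missed (p , sp)

-- Extending a colouring by a vertex of degree three

module _ {V : Set} where

  -- Cyclic in `y`, `z`, `w`, so that rotating the three is a mere renaming of fields.
  record Distinct (x y z w : V) : Set where
    field
      x≢y : x ≢ y
      x≢z : x ≢ z
      x≢w : x ≢ w
      y≢z : y ≢ z
      z≢w : z ≢ w
      w≢y : w ≢ y

  distinct-rotate : ∀ {x y z w} → Distinct x y z w → Distinct x z w y
  distinct-rotate d = record
    { x≢y = x≢z ; x≢z = x≢w ; x≢w = x≢y ; y≢z = z≢w ; z≢w = w≢y ; w≢y = y≢z }
    where open Distinct d

  distinct-swap : ∀ {x y z w} → Distinct x y z w → Distinct x z y w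
  distinct-swap d = record
    { x≢y = x≢z ; x≢z = x≢y ; x≢w = x≢w ; y≢z = ≢-sym y≢z ; z≢w = ≢-sym w≢y ; w≢y = ≢-sym z≢w }
    where open Distinct d

module _ {V K : Set} where

  Coloured : Colouring V K → V → V → Set
  Coloured C u v = ∃[ a ] C u v ≡ just a

  -- Old edges must stay coloured but may change colour, since an exchange recolours two of them.
  record Extension (C : Colouring V K) (x y z w : V) : Set where
    field
      colouring : Colouring V K
      good      : Good colouring
      support   : ∀ {u v} → Coloured C u v → Coloured colouring u v
      xy        : Coloured colouring x y
      xz        : Coloured colouring x z
      xw        : Coloured colouring x w

  extension-rotate : ∀ {C x y z w} → Extension C x z w y → Extension C x y z w
  extension-rotate e = record
    { colouring = colouring ; good = good ; support = support ; xy = xw ; xz = xy ; xw = xz }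
    where open Extension e

  extension-weaken : ∀ {C D x y z w} → (∀ {u v} → Coloured C u v → Coloured D u v) →
                     Extension D x y z w → Extension C x y z w
  extension-weaken C⊆D e = record
    { colouring = colouring ; good = good ; support = support ∘ C⊆D ; xy = xy ; xz = xz ; xw = xw }
    where open Extension e

  extension-swap : ∀ {C x y z w} → Extension C x z y w → Extension C x y z w
  extension-swap e = record
    { colouring = colouring ; good = good ; support = support ; xy = xz ; xz = xy ; xw = xw }
    where open Extension e

  Isolated : Colouring V K → V → Set
  Isolated C x = ∀ {a} → ¬ Sees C x a

  sees-same : ∀ {C : Colouring V K} → Good C → ∀ {u v w a c} →
              C u v ≡ just a → C u w ≡ just a × Sees C w c → Sees C v c
  sees-same {C} good e (f , w-sees) = subst (λ v → Sees C v _) (Good.proper good f e) w-sees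

module _ {V K : Set} (_≟_ : DecidableEquality V) where

  module _ {C : Colouring V K} (good : Good C) {x y z w : V} (distinct : Distinct x y z w)
           (isolated : Isolated C x) {a b c : K} (a≢b : a ≢ b) (b≢c : b ≢ c) (c≢a : c ≢ a)
           (y-misses : ¬ Sees C y a) (z-misses : ¬ Sees C z b) (w-misses : ¬ Sees C w c)
           (yz : ¬ Critical good y a z b) (zw : ¬ Critical good z b w c)
           (wy : ¬ Critical good w c y a)
           where
    open Distinct distinct

    private
      f : V → Maybe K
      f v with v ≟ y | v ≟ z | v ≟ w
      ... | yes _ | _     | _     = just a
      ... | no _  | yes _ | _     = just b
      ... | no _  | no _  | yes _ = just c
      ... | no _  | no _  | no _  = nothing

      data Leaf (v : V) : Maybe K → Set where
        is-y : v ≡ y → Leaf v (just a)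
        is-z : v ≡ z → Leaf v (just b)
        is-w : v ≡ w → Leaf v (just c)
        none : v ≢ y → v ≢ z → v ≢ w → Leaf v nothing

      leaf : ∀ v → Leaf v (f v)
      leaf v with v ≟ y | v ≟ z | v ≟ w
      ... | yes v≡y | _       | _       = is-y v≡y
      ... | no _    | yes v≡z | _       = is-z v≡z
      ... | no _    | no _    | yes v≡w = is-w v≡w
      ... | no v≢y  | no v≢z  | no v≢w  = none v≢y v≢z v≢w

      leaf-just : ∀ {v d} → f v ≡ just d → Leaf v (just d)
      leaf-just {v} e = subst (Leaf v) e (leaf v)

      f-injective : ∀ {u v d} → f u ≡ just d → f v ≡ just d → u ≡ v
      f-injective e g with leaf-just e | leaf-just g
      ... | is-y refl | is-y refl = refl
      ... | is-y refl | is-z refl = contradiction refl a≢b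
      ... | is-y refl | is-w refl = contradiction refl c≢a
      ... | is-z refl | is-y refl = contradiction refl a≢b
      ... | is-z refl | is-z refl = refl
      ... | is-z refl | is-w refl = contradiction refl b≢c
      ... | is-w refl | is-y refl = contradiction refl c≢a
      ... | is-w refl | is-z refl = contradiction refl b≢c
      ... | is-w refl | is-w refl = refl

      f-unseen : ∀ {v d} → f v ≡ just d → ¬ Sees C v d
      f-unseen e with leaf-just e
      ... | is-y refl = y-misses
      ... | is-z refl = z-misses
      ... | is-w refl = w-misses

      uncritical : ∀ {u v d e} → u ≢ v → f u ≡ just d → f v ≡ just e → ¬ Critical good u d v e
      uncritical u≢v e g with leaf-just e | leaf-just g
      ... | is-y refl | is-y refl = contradiction refl u≢v
      ... | is-y refl | is-z refl = yz
      ... | is-y refl | is-w refl = wy ∘ critical-sym good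
      ... | is-z refl | is-y refl = yz ∘ critical-sym good
      ... | is-z refl | is-z refl = contradiction refl u≢v
      ... | is-z refl | is-w refl = zw
      ... | is-w refl | is-y refl = wy
      ... | is-w refl | is-z refl = zw ∘ critical-sym good
      ... | is-w refl | is-w refl = contradiction refl u≢v

      fx : f x ≡ nothing
      fx with f x | leaf x
      ... | _ | is-y x≡y   = contradiction x≡y x≢y
      ... | _ | is-z x≡z   = contradiction x≡z x≢z
      ... | _ | is-w x≡w   = contradiction x≡w x≢w
      ... | _ | none _ _ _ = refl

      new : ∀ {v} → v ≡ y ⊎ v ≡ z ⊎ v ≡ w → Coloured (attach _≟_ C x f) x v
      new {v} v-leaf with f v | leaf v | attach-at _≟_ C x f v
      ... | _ | is-y _ | e = _ , e
      ... | _ | is-z _ | e = _ , e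
      ... | _ | is-w _ | e = _ , e
      ... | _ | none v≢y v≢z v≢w | _ = ⊥-elim ([ v≢y , [ v≢z , v≢w ]′ ]′ v-leaf)

    extend : Extension C x y z w
    extend = record
      { colouring = attach _≟_ C x f
      ; good      = attach-good _≟_ good (λ e → isolated (_ , e)) fx f-injective f-unseen uncritical
      ; support   = λ (d , e) → d , trans (attach-off _≟_ C x f (λ { refl → isolated (_ , e) })
                                          (λ { refl → isolated (_ , Good.symmetric good e) })) e
      ; xy        = new (inj₁ refl)
      ; xz        = new (inj₂ (inj₁ refl))
      ; xw        = new (inj₂ (inj₂ refl))
      }

  module _ {C : Colouring V K} (good : Good C) {x y z w : V} (distinct : Distinct x y z w)
           (isolated : Isolated C x) (≤4 : ∀ v → AtMost 4 C v)
           (disjoint : ∀ {c d} → ¬ Sees C y c → ¬ Sees C z d → c ≢ d)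
           where
    open Distinct distinct
    open Good good

    -- w misses colours of both y and z: every choice of α₁ or α₂ for x y
    -- and of some β for x z could be completed, so all are critical, and
    -- exchanging α₁ and α₂ at z destroys the critical walk for α₁, β₁.
    extend-mixed : ∀ {α₁ α₂ β₁ β₂ β₃} → α₁ ≢ α₂ → Unique (β₁ ∷ β₂ ∷ β₃ ∷ []) →
      ¬ Sees C y α₁ → ¬ Sees C y α₂ → ¬ Sees C w α₁ → ¬ Sees C w α₂ →
      ¬ Sees C z β₁ → ¬ Sees C z β₂ → ¬ Sees C z β₃ → ¬ Sees C w β₁ →
      ¬ ¬ Extension C x y z w
    extend-mixed {α₁} {α₂} {β₁} {β₂} {β₃} α₁≢α₂
      βs-unique@((β₁≢β₂ ∷ β₁≢β₃ ∷ []) ∷ _) y₁ y₂ w₁ w₂ z₁ z₂ z₃ wβ₁ none =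
      critical₁ α₁≢α₂ y₁ y₂ w₁ w₂ λ c₁₁ →
      critical₂ y₁ w₁ z₂ β₁≢β₂ λ c₁₂ →
      critical₂ y₁ w₁ z₃ β₁≢β₃ λ c₁₃ →
      critical₁ (≢-sym α₁≢α₂) y₂ y₁ w₂ w₁ λ c₂₁ →
      critical₂ y₂ w₂ z₂ β₁≢β₂ λ c₂₂ →
      critical₂ y₂ w₂ z₃ β₁≢β₃ λ c₂₃ →
      none (exchanged c₁₁ (sees-all y₁ c₁₁ c₁₂ c₁₃) (sees-all y₂ c₂₁ c₂₂ c₂₃))
      where
      -- Here `w` takes the other `α′`. It misses both `α` and `β₁`, so only the pair of `y` and `z`
      -- can be critical.
      critical₁ : ∀ {α α′} → α ≢ α′ → ¬ Sees C y α → ¬ Sees C y α′ →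
                  ¬ Sees C w α → ¬ Sees C w α′ → ¬ ¬ Critical good y α z β₁
      critical₁ α≢α′ yα yα′ wα wα′ ¬critical = none (extend good distinct isolated
        (disjoint yα z₁) (≢-sym (disjoint yα′ z₁)) (≢-sym α≢α′) yα z₁ wα′
        ¬critical (missed₂ good z≢w wβ₁) (missed₁ good w≢y wα))

      -- Here `w` takes `β₁`. As `z` misses `β₁` and `w` misses `α`, again only `y` and `z` can
      -- clash.
      critical₂ : ∀ {α β} → ¬ Sees C y α → ¬ Sees C w α → ¬ Sees C z β → β₁ ≢ β →
                  ¬ ¬ Critical good y α z β
      critical₂ yα wα zβ β₁≢β ¬critical = none (extend good distinct isolated
        (disjoint yα zβ) (≢-sym β₁≢β) (≢-sym (disjoint yα z₁)) yα zβ wβ₁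
        ¬critical (missed₁ good z≢w z₁) (missed₁ good w≢y wα))

      Full : K → Set
      Full α = ∃[ t ] C z t ≡ just α × All (Sees C t) (β₁ ∷ β₂ ∷ β₃ ∷ [])

      -- The three critical walks all reach `z` through its `α`-edge, so one neighbour sees every
      -- `β`.
      sees-all : ∀ {α} → ¬ Sees C y α → Critical good y α z β₁ → Critical good y α z β₂ →
                 Critical good y α z β₃ → Full α
      sees-all yα c₁ c₂ c₃ =
        let t , e , s₁ = end z₁ c₁
            _ , s₂ = end z₂ c₂
            _ , s₃ = end z₃ c₃
        in t , e , s₁ ∷ sees-same good e s₂ ∷ sees-same good e s₃ ∷ []
        where
        end : ∀ {β} → ¬ Sees C z β → Critical good y _ z β → _
        end zβ c = critical-start good (≢-sym y≢z) (≢-sym (disjoint yα zβ)) (critical-sym good c)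

      exchanged : Critical good y α₁ z β₁ → Full α₁ → Full α₂ → Extension C x y z w
      exchanged c₁₁ (p , zp , p-sees@(pβ₁ ∷ _)) (q , zq , q-sees@(qβ₁ ∷ _)) =
        extension-weaken (λ (_ , e) → exchange-support e) (extend exchange-good distinct
          (isolated ∘ exchange-sees (λ { refl → isolated pβ₁ }) (λ { refl → isolated qβ₁ }))
          (disjoint y₁ z₁) (≢-sym (disjoint y₂ z₁)) (≢-sym α₁≢α₂)
          (y-misses y₁) (z-misses z₁) (w-misses w₂)
          (exchange-uncritical y≢z z₁ c₁₁ (z-misses z₁))
          (missed₂ exchange-good z≢w (w-misses wβ₁))
          (missed₁ exchange-good w≢y (w-misses w₁)))
        where
        open Exchange _≟_ good zp zq α₁≢α₂ βs-unique refl (z₁ ∷ z₂ ∷ z₃ ∷ []) p-sees q-sees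
                      (≤4 p) (≤4 q)
        y-misses : ∀ {c} → ¬ Sees C y c → ¬ Sees exchange y c
        y-misses ¬seen = ¬seen ∘ exchange-sees (λ { refl → y₁ (_ , symmetric zp) })
                                               (λ { refl → y₂ (_ , symmetric zq) })
        w-misses : ∀ {c} → ¬ Sees C w c → ¬ Sees exchange w c
        w-misses ¬seen = ¬seen ∘ exchange-sees (λ { refl → wβ₁ pβ₁ }) (λ { refl → wβ₁ qβ₁ })
        z-misses : ∀ {c} → ¬ Sees C z c → ¬ Sees exchange z c
        z-misses ¬seen = ¬seen ∘ exchange-sees-centre

    AllCritical : V → K → K → K → K → Set
    AllCritical u α₁ α₂ α₃ β =
      Critical good u α₁ z β × Critical good u α₂ z β × Critical good u α₃ z β

    -- The exchange is now made at `y`: the far ends of its edges coloured `β` and `β′` see all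
    -- three `α`s. The walks from `z` that alternate between `β` and `α₁` or `α₂` used to end at `y`
    -- through the `β`-edge. They now stop before `y`, so neither `α₁` at `y` nor `α₂` at `w`
    -- clashes with `β` at `z`.
    extend-exchanged : ∀ {α₁ α₂ α₃ β β′} → Unique (α₁ ∷ α₂ ∷ α₃ ∷ []) → β ≢ β′ →
      ¬ Sees C y α₁ → ¬ Sees C y α₂ → ¬ Sees C y α₃ → ¬ Sees C w α₁ → ¬ Sees C w α₂ →
      ¬ Sees C z β → ¬ Sees C z β′ →
      AllCritical y α₁ α₂ α₃ β → AllCritical y α₁ α₂ α₃ β′ → Extension C x y z w
    extend-exchanged {α₁} {α₂} {α₃} {β} {β′} αs-unique@((α₁≢α₂ ∷ _) ∷ _) β≢β′
      y₁ y₂ y₃ w₁ w₂ zβ zβ′ crit@(c₁ , c₂ , _) crit′ =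
      exchanged (sees-all zβ crit) (sees-all zβ′ crit′)
      where
      Full : K → Set
      Full β = ∃[ t ] C y t ≡ just β × All (Sees C t) (α₁ ∷ α₂ ∷ α₃ ∷ [])

      sees-all : ∀ {β} → ¬ Sees C z β → AllCritical y α₁ α₂ α₃ β → Full β
      sees-all zβ (c₁ , c₂ , c₃) =
        let t , e , s₁ = start y₁ c₁
            _ , s₂ = start y₂ c₂
            _ , s₃ = start y₃ c₃
        in t , e , s₁ ∷ sees-same good e s₂ ∷ sees-same good e s₃ ∷ []
        where
        start : ∀ {α} → ¬ Sees C y α → Critical good y α z _ → _
        start yα c = critical-start good y≢z (disjoint yα zβ) c

      exchanged : Full β → Full β′ → Extension C x y z w
      exchanged (p , yp , p-sees@(pα₁ ∷ _)) (q , yq , q-sees@(qα₁ ∷ _)) =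
        extension-weaken (λ (_ , e) → exchange-support e) (extend exchange-good distinct
          (isolated ∘ exchange-sees (λ { refl → isolated pα₁ }) (λ { refl → isolated qα₁ }))
          (disjoint y₁ zβ) (≢-sym (disjoint y₂ zβ)) (≢-sym α₁≢α₂)
          (y-misses y₁) (z-misses zβ) (w-misses w₂)
          (exchange-uncritical (≢-sym y≢z) y₁ (critical-sym good c₁) (y-misses y₁) ∘
            critical-sym exchange-good)
          (exchange-uncritical (≢-sym y≢z) y₂ (critical-sym good c₂) (w-misses w₂))
          (missed₁ exchange-good w≢y (w-misses w₁)))
        where
        open Exchange _≟_ good yp yq β≢β′ αs-unique refl (y₁ ∷ y₂ ∷ y₃ ∷ []) p-sees q-sees
                      (≤4 p) (≤4 q)
        z-misses : ∀ {c} → ¬ Sees C z c → ¬ Sees exchange z c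
        z-misses ¬seen = ¬seen ∘ exchange-sees (λ { refl → zβ (_ , symmetric yp) })
                                               (λ { refl → zβ′ (_ , symmetric yq) })
        w-misses : ∀ {c} → ¬ Sees C w c → ¬ Sees exchange w c
        w-misses ¬seen = ¬seen ∘ exchange-sees (λ { refl → w₁ pα₁ }) (λ { refl → w₁ qα₁ })
        y-misses : ∀ {c} → ¬ Sees C y c → ¬ Sees exchange y c
        y-misses ¬seen = ¬seen ∘ exchange-sees-centre

  module _ {C : Colouring V K} (good : Good C) {x y z w : V} (distinct : Distinct x y z w)
           (isolated : Isolated C x) (≤4 : ∀ v → AtMost 4 C v)
           (disjoint : ∀ {c d} → ¬ Sees C y c → ¬ Sees C z d → c ≢ d)
           (disjoint′ : ∀ {c d} → ¬ Sees C w c → ¬ Sees C z d → c ≢ d)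
           where
    open Distinct distinct

    -- y and w miss the same three colours.  For each β the walks from z
    -- end all at y or all at w, and two of three β's agree.
    extend-parallel : ∀ {α₁ α₂ α₃ β₁ β₂ β₃} →
      Unique (α₁ ∷ α₂ ∷ α₃ ∷ []) → Unique (β₁ ∷ β₂ ∷ β₃ ∷ []) →
      ¬ Sees C y α₁ → ¬ Sees C y α₂ → ¬ Sees C y α₃ →
      ¬ Sees C w α₁ → ¬ Sees C w α₂ → ¬ Sees C w α₃ →
      ¬ Sees C z β₁ → ¬ Sees C z β₂ → ¬ Sees C z β₃ →
      ¬ ¬ Extension C x y z w
    extend-parallel {α₁} {α₂} {α₃} αs-unique@((α₁≢α₂ ∷ α₁≢α₃ ∷ []) ∷ (α₂≢α₃ ∷ []) ∷ _)
      ((β₁≢β₂ ∷ β₁≢β₃ ∷ []) ∷ (β₂≢β₃ ∷ []) ∷ _) y₁ y₂ y₃ w₁ w₂ w₃ z₁ z₂ z₃ none =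
      one-end z₁ λ e₁ → one-end z₂ λ e₂ → one-end z₃ λ e₃ → none (agree e₁ e₂ e₃)
      where
      Y W : K → K → Set
      Y α β = Critical good y α z β
      W α β = Critical good w α z β

      exclusive : ∀ {α β} → ¬ Sees C y α → ¬ Sees C w α → Y α β → ¬ W α β
      exclusive yα wα c d with stuck-unique good (critical-sym good c) (unseen⇒stuck good yα)
                                                 (critical-sym good d) (unseen⇒stuck good wα)
      ... | refl = w≢y refl

      either : ∀ {α α′ β} → α ≢ α′ → ¬ Sees C y α → ¬ Sees C w α → ¬ Sees C w α′ →
               ¬ Sees C z β → ¬ ¬ (Y α β ⊎ W α′ β)
      either α≢α′ yα wα wα′ zβ neither = none (extend good distinct isolated
        (disjoint yα zβ) (≢-sym (disjoint′ wα′ zβ)) (≢-sym α≢α′) yα zβ wα′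
        (neither ∘ inj₁) (neither ∘ inj₂ ∘ critical-sym good) (missed₁ good w≢y wα))

      AllY AllW : K → Set
      AllY β = Y α₁ β × Y α₂ β × Y α₃ β
      AllW β = W α₁ β × W α₂ β × W α₃ β

      -- By `exclusive` the disjunctions propagate: `Y α₁ β` rules out `W α₁ β` and so forces `Y` at
      -- `α₂` and `α₃`, while `W α₂ β` rules out `Y α₂ β` and so forces `W` at `α₁` and `α₃`.
      one-end : ∀ {β} → ¬ Sees C z β → ¬ ¬ (AllY β ⊎ AllW β)
      one-end {β} zβ k =
        either α₁≢α₂ y₁ w₁ w₂ zβ λ d₁₂ →
        either (≢-sym α₁≢α₂) y₂ w₂ w₁ zβ λ d₂₁ →
        either (≢-sym α₁≢α₃) y₃ w₃ w₁ zβ λ d₃₁ →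
        either α₂≢α₃ y₂ w₂ w₃ zβ λ d₂₃ → k (decide d₁₂ d₂₁ d₃₁ d₂₃)
        where
        decide : Y α₁ β ⊎ W α₂ β → Y α₂ β ⊎ W α₁ β → Y α₃ β ⊎ W α₁ β → Y α₂ β ⊎ W α₃ β →
                 AllY β ⊎ AllW β
        decide (inj₁ c₁) (inj₁ c₂) (inj₁ c₃) _ = inj₁ (c₁ , c₂ , c₃)
        decide (inj₁ c₁) (inj₂ d₁) _ _ = contradiction d₁ (exclusive y₁ w₁ c₁)
        decide (inj₁ c₁) _ (inj₂ d₁) _ = contradiction d₁ (exclusive y₁ w₁ c₁)
        decide (inj₂ d₂) (inj₂ d₁) _ (inj₂ d₃) = inj₂ (d₁ , d₂ , d₃)
        decide (inj₂ d₂) (inj₁ c₂) _ _ = contradiction d₂ (exclusive y₂ w₂ c₂)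
        decide (inj₂ d₂) _ _ (inj₁ c₂) = contradiction d₂ (exclusive y₂ w₂ c₂)

      both-y : ∀ {β β′} → β ≢ β′ → ¬ Sees C z β → ¬ Sees C z β′ →
               AllY β → AllY β′ → Extension C x y z w
      both-y β≢β′ = extend-exchanged good distinct isolated ≤4 disjoint αs-unique β≢β′
                                     y₁ y₂ y₃ w₁ w₂

      both-w : ∀ {β β′} → β ≢ β′ → ¬ Sees C z β → ¬ Sees C z β′ →
               AllW β → AllW β′ → Extension C x y z w
      both-w β≢β′ zβ zβ′ c c′ = extension-rotate (extension-swap (
        extend-exchanged good (distinct-swap (distinct-rotate distinct)) isolated ≤4 disjoint′
                         αs-unique β≢β′ w₁ w₂ w₃ y₁ y₂ zβ zβ′ c c′))

      agree : AllY _ ⊎ AllW _ → AllY _ ⊎ AllW _ → AllY _ ⊎ AllW _ → Extension C x y z w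
      agree (inj₁ c₁) (inj₁ c₂) _         = both-y β₁≢β₂ z₁ z₂ c₁ c₂
      agree (inj₁ c₁) (inj₂ _)  (inj₁ c₃) = both-y β₁≢β₃ z₁ z₃ c₁ c₃
      agree (inj₁ _)  (inj₂ d₂) (inj₂ d₃) = both-w β₂≢β₃ z₂ z₃ d₂ d₃
      agree (inj₂ _)  (inj₁ c₂) (inj₁ c₃) = both-y β₂≢β₃ z₂ z₃ c₂ c₃
      agree (inj₂ d₁) (inj₁ _)  (inj₂ d₃) = both-w β₁≢β₃ z₁ z₃ d₁ d₃
      agree (inj₂ d₁) (inj₂ d₂) _         = both-w β₁≢β₂ z₁ z₂ d₁ d₂

-- Choosing among six colours

unique-⊆-length : ∀ {A : Set} {xs ys : List A} → Unique xs → xs ⊆ ys → length xs ≤ length ys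
unique-⊆-length {xs = []}     _                 _     = z≤n
unique-⊆-length {xs = x ∷ xs} (x∉xs ∷ xs-unique) xs⊆ys with ∈-∃++ (xs⊆ys (here refl))
... | as , bs , refl = subst (suc (length xs) ≤_) (sym ∣ys∣) (s≤s (unique-⊆-length xs-unique shrink))
  where
  ∣ys∣ : length (as ++ x ∷ bs) ≡ suc (length (as ++ bs))
  ∣ys∣ = trans (length-++ as) (trans (ℕ.+-suc (length as) (length bs)) (cong suc (sym (length-++ as))))
  shrink : xs ⊆ as ++ bs
  shrink {v} v∈xs with ∈-++⁻ as (xs⊆ys (there v∈xs))
  ... | inj₁ v∈as          = ∈-++⁺ˡ v∈as
  ... | inj₂ (here refl)   = contradiction refl (All.lookup x∉xs v∈xs)
  ... | inj₂ (there v∈bs)  = ∈-++⁺ʳ as v∈bs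

unique-length : ∀ {n} {xs : List (Fin n)} → Unique xs → length xs ≤ n
unique-length {n} {xs} xs-unique = subst (length xs ≤_) (length-tabulate id)
  (unique-⊆-length xs-unique (λ {v} _ → ∈-allFin v))

-- Opaque, since case analyses on the search would otherwise unfold it.
abstract
  search? : ∀ {n} {P : Fin n → Set} → (∀ i → Dec (P i)) → Dec (∃ P)
  search? = Fin.any?

-- Double negation commutes with finite products. It lets a doubly negated proof search for missing
-- colours.
¬¬-all-dec : ∀ {n} {P : Fin n → Set} → ¬ ¬ (∀ i → Dec (P i))
¬¬-all-dec = Fin.sequence (RawMonad.rawApplicative ¬¬-Monad) (λ _ → ¬¬-excluded-middle)

unique₃ : ∀ {A : Set} {a b c : A} → a ≢ b → a ≢ c → b ≢ c → Unique (a ∷ b ∷ c ∷ [])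
unique₃ a≢b a≢c b≢c = (a≢b ∷ a≢c ∷ []) ∷ (b≢c ∷ []) ∷ [] ∷ []

module _ {V : Set} (_≟_ : DecidableEquality V) {C : Colouring V (Fin 6)} (good : Good C) where

  Misses : V → Fin 6 → Set
  Misses v c = ¬ Sees C v c

  Seen? : V → Set
  Seen? v = ∀ c → Dec (Sees C v c)

  -- At most three colours are seen and at most two excluded.
  fresh : ∀ {v} → Seen? v → AtMost 3 C v → ∀ cs → length cs ≤ 2 → ∃[ c ] Misses v c × All (c ≢_) cs
  fresh {v} seen? v≤3 cs ∣cs∣≤2 with search? (λ c → ¬? (seen? c) ×-dec All.all? (λ d → ¬? (c Fin.≟ d)) cs)
  ... | yes found = found
  ... | no none   = contradiction (ℕ.≤-trans six five) λ { (s≤s (s≤s (s≤s (s≤s (s≤s ()))))) }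
    where
    seen = filter seen? (allFin 6)
    covered : allFin 6 ⊆ cs ++ seen
    covered {c} _ with seen? c | All.all? (λ d → ¬? (c Fin.≟ d)) cs
    ... | yes s | _     = ∈-++⁺ʳ cs (∈-filter⁺ seen? (∈-allFin c) s)
    ... | no ¬s | yes f = contradiction (c , ¬s , f) none
    ... | no _  | no ¬f = ∈-++⁺ˡ (stable ¬f)
      where
      open import Data.List.Membership.DecPropositional (Fin._≟_ {6}) using (_∈?_)
      stable : ¬ All (c ≢_) cs → c ∈ cs
      stable ¬f with c ∈? cs
      ... | yes c∈cs = c∈cs
      ... | no c∉cs  = contradiction (¬Any⇒All¬ cs c∉cs) ¬f
    six : 6 ≤ length (cs ++ seen)
    six = unique-⊆-length (allFin⁺ 6) covered
    five : length (cs ++ seen) ≤ 5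
    five = subst (_≤ 5) (sym (length-++ cs)) (ℕ.+-mono-≤ ∣cs∣≤2
      (v≤3 seen (filter⁺ seen? (allFin⁺ 6)) (all-filter seen? (allFin 6))))

  module _ {v} (seen? : Seen? v) (v≤3 : AtMost 3 C v) where

    third-missed : ∀ a b → ∃[ c ] Misses v c × a ≢ c × b ≢ c
    third-missed a b with fresh seen? v≤3 (a ∷ b ∷ []) (s≤s (s≤s z≤n))
    ... | c , vc , c≢a ∷ c≢b ∷ [] = c , vc , ≢-sym c≢a , ≢-sym c≢b

    two-missed : ∀ a → ∃[ b ] ∃[ c ] Misses v b × Misses v c × a ≢ b × a ≢ c × b ≢ c
    two-missed a =
      let b , vb , a≢b , _   = third-missed a a
          c , vc , a≢c , b≢c = third-missed a b
      in b , c , vb , vc , a≢b , a≢c , b≢c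

    three-missed : ∃[ a ] ∃[ b ] ∃[ c ] Misses v a × Misses v b × Misses v c × a ≢ b × a ≢ c × b ≢ c
    three-missed = let a , va , _ = fresh seen? v≤3 [] z≤n
                       b , c , vb , vc , rest = two-missed a
                   in a , b , c , va , vb , vc , rest

  module _ {x : V} (isolated : Isolated C x) (≤4 : ∀ v → AtMost 4 C v) where

    Disjoint : V → V → Set
    Disjoint y z = ∀ {c d} → Misses y c → Misses z d → c ≢ d

    module _ {y z w} (distinct : Distinct x y z w) (z? : Seen? z) (w? : Seen? w)
             (z≤3 : AtMost 3 C z) (y#z : Disjoint y z)
             (cover : ∀ c → Misses y c ⊎ Misses z c) where

      -- A colour missed by both `w` and `z` serves as `β₁` in `extend-mixed`. If there is none,
      -- `cover` puts the third colour of `w` at `y` too, and the parallel case applies.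
      extend-disjoint-two : ∀ {c₁ c₂ c₃} → c₁ ≢ c₂ → c₂ ≢ c₃ → c₁ ≢ c₃ →
        Misses w c₁ → Misses w c₂ → Misses w c₃ → Misses y c₁ → Misses y c₂ →
        ¬ ¬ Extension C x y z w
      extend-disjoint-two c₁≢c₂ c₂≢c₃ c₁≢c₃ w₁ w₂ w₃ y₁ y₂
        with search? (λ c → ¬? (w? c) ×-dec ¬? (z? c))
      ... | yes (β₁ , wβ₁ , zβ₁) =
        let β₂ , β₃ , zβ₂ , zβ₃ , β₁₂ , β₁₃ , β₂₃ = two-missed z? z≤3 β₁
        in extend-mixed _≟_ good distinct isolated ≤4 y#z c₁≢c₂ (unique₃ β₁₂ β₁₃ β₂₃)
                        y₁ y₂ w₁ w₂ zβ₁ zβ₂ zβ₃ wβ₁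
      ... | no none with cover _
      ...   | inj₂ z₃ = contradiction (_ , w₃ , z₃) none
      ...   | inj₁ y₃ =
        let β₁ , β₂ , β₃ , zβ₁ , zβ₂ , zβ₃ , β₁₂ , β₁₃ , β₂₃ = three-missed z? z≤3
        in extend-parallel _≟_ good distinct isolated ≤4 y#z
             (λ wc zd c≡d → none (_ , wc , subst (Misses z) (sym c≡d) zd))
             (unique₃ c₁≢c₂ c₁≢c₃ c₂≢c₃) (unique₃ β₁₂ β₁₃ β₂₃)
             y₁ y₂ y₃ w₁ w₂ w₃ zβ₁ zβ₂ zβ₃

    module _ {y z w} (distinct : Distinct x y z w) (y? : Seen? y) (z? : Seen? z) (w? : Seen? w)
             (y≤3 : AtMost 3 C y) (z≤3 : AtMost 3 C z) (w≤3 : AtMost 3 C w) where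
      open Distinct distinct

      -- A colour seen at both would be a seventh besides the three missing at `y` and the three
      -- missing at `z`.
      cover-disjoint : Disjoint y z → ∀ c → Misses y c ⊎ Misses z c
      cover-disjoint y#z c with y? c | z? c
      ... | no ¬s  | _      = inj₁ ¬s
      ... | yes _  | no ¬s  = inj₂ ¬s
      ... | yes ys | yes zs =
        let _ , _ , _ , y₁ , y₂ , y₃ , α₁₂ , α₁₃ , α₂₃ = three-missed y? y≤3
            _ , _ , _ , z₁ , z₂ , z₃ , β₁₂ , β₁₃ , β₂₃ = three-missed z? z≤3
            apart : ∀ {v d} → Sees C v c → Misses v d → c ≢ d
            apart = λ s m c≡d → m (subst (Sees C _) c≡d s)
        in contradiction
             (unique-length
               ((apart ys y₁ ∷ apart ys y₂ ∷ apart ys y₃ ∷ apart zs z₁ ∷ apart zs z₂ ∷ apart zs z₃ ∷ [])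
               ∷ (α₁₂ ∷ α₁₃ ∷ y#z y₁ z₁ ∷ y#z y₁ z₂ ∷ y#z y₁ z₃ ∷ [])
               ∷ (α₂₃ ∷ y#z y₂ z₁ ∷ y#z y₂ z₂ ∷ y#z y₂ z₃ ∷ [])
               ∷ (y#z y₃ z₁ ∷ y#z y₃ z₂ ∷ y#z y₃ z₃ ∷ [])
               ∷ unique₃ β₁₂ β₁₃ β₂₃))
             ℕ.1+n≰n

      extend-disjoint : Disjoint y z → ¬ ¬ Extension C x y z w
      extend-disjoint y#z with three-missed w? w≤3
      ... | c₁ , c₂ , c₃ , w₁ , w₂ , w₃ , c₁₂ , c₁₃ , c₂₃ =
        cases (cover c₁) (cover c₂) (cover c₃)
        where
        cover = cover-disjoint y#z
        two-y : ∀ {c₁ c₂ c₃} → c₁ ≢ c₂ → c₂ ≢ c₃ → c₁ ≢ c₃ →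
                Misses w c₁ → Misses w c₂ → Misses w c₃ → Misses y c₁ → Misses y c₂ →
                ¬ ¬ Extension C x y z w
        two-y = extend-disjoint-two distinct z? w? z≤3 y#z cover
        two-z : ∀ {c₁ c₂ c₃} → c₁ ≢ c₂ → c₂ ≢ c₃ → c₁ ≢ c₃ →
                Misses w c₁ → Misses w c₂ → Misses w c₃ → Misses z c₁ → Misses z c₂ →
                ¬ ¬ Extension C x y z w
        two-z c₁₂ c₂₃ c₁₃ w₁ w₂ w₃ z₁ z₂ none =
          extend-disjoint-two (distinct-swap distinct) y? w? y≤3
            (λ zc yd → ≢-sym (y#z yd zc)) ([ inj₂ , inj₁ ]′ ∘ cover)
            c₁₂ c₂₃ c₁₃ w₁ w₂ w₃ z₁ z₂ (none ∘ extension-swap)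
        cases : Misses y c₁ ⊎ Misses z c₁ → Misses y c₂ ⊎ Misses z c₂ → Misses y c₃ ⊎ Misses z c₃ →
                ¬ ¬ Extension C x y z w
        cases (inj₁ y₁) (inj₁ y₂) _         = two-y c₁₂ c₂₃ c₁₃ w₁ w₂ w₃ y₁ y₂
        cases (inj₁ y₁) (inj₂ _)  (inj₁ y₃) = two-y c₁₃ (≢-sym c₂₃) c₁₂ w₁ w₃ w₂ y₁ y₃
        cases (inj₂ _)  (inj₁ y₂) (inj₁ y₃) = two-y c₂₃ (≢-sym c₁₃) (≢-sym c₁₂) w₂ w₃ w₁ y₂ y₃
        cases (inj₂ z₁) (inj₂ z₂) _         = two-z c₁₂ c₂₃ c₁₃ w₁ w₂ w₃ z₁ z₂
        cases (inj₂ z₁) (inj₁ _)  (inj₂ z₃) = two-z c₁₃ (≢-sym c₂₃) c₁₂ w₁ w₃ w₂ z₁ z₃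
        cases (inj₁ _)  (inj₂ z₂) (inj₂ z₃) = two-z c₂₃ (≢-sym c₁₃) (≢-sym c₁₂) w₂ w₃ w₁ z₂ z₃

      -- `w` takes `t`, `y` takes `c` and `z` takes a third colour `d`. Since `y` and `z` miss `t`
      -- and `z` misses `c`, no pair is critical.
      extend-common : ∀ {t c} → c ≢ t → Misses y t → Misses z t → Misses w t →
                      Misses y c → Misses z c → Extension C x y z w
      extend-common {t} {c} c≢t yt zt wt yc zc =
        let d , zd , t≢d , c≢d = third-missed z? z≤3 t c
        in extend _≟_ good distinct isolated c≢d (≢-sym t≢d) (≢-sym c≢t) yc zd wt
             (missed₂ good y≢z zc) (missed₁ good z≢w zt) (missed₂ good w≢y yt)

      -- Otherwise `t` and two further colours at each of the three vertices would be seven distinct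
      -- colours.
      second-common : ∀ t → ∃[ c ] c ≢ t × (Misses y c × Misses z c ⊎ Misses z c × Misses w c ⊎
                                            Misses w c × Misses y c)
      second-common t
        with search? (λ c → ¬? (c Fin.≟ t) ×-dec
               ((¬? (y? c) ×-dec ¬? (z? c)) ⊎-dec (¬? (z? c) ×-dec ¬? (w? c)) ⊎-dec
                (¬? (w? c) ×-dec ¬? (y? c))))
      ... | yes found = found
      ... | no none =
        let y₁ , y₂ , my₁ , my₂ , t≢y₁ , t≢y₂ , y₁≢y₂ = two-missed y? y≤3 t
            z₁ , z₂ , mz₁ , mz₂ , t≢z₁ , t≢z₂ , z₁≢z₂ = two-missed z? z≤3 t
            w₁ , w₂ , mw₁ , mw₂ , t≢w₁ , t≢w₂ , w₁≢w₂ = two-missed w? w≤3 t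
            y#z : ∀ {c d} → t ≢ c → Misses y c → Misses z d → c ≢ d
            y#z = λ { t≢c yc zd refl → none (_ , ≢-sym t≢c , inj₁ (yc , zd)) }
            z#w : ∀ {c d} → t ≢ c → Misses z c → Misses w d → c ≢ d
            z#w = λ { t≢c zc wd refl → none (_ , ≢-sym t≢c , inj₂ (inj₁ (zc , wd))) }
            y#w : ∀ {c d} → t ≢ c → Misses y c → Misses w d → c ≢ d
            y#w = λ { t≢c yc wd refl → none (_ , ≢-sym t≢c , inj₂ (inj₂ (wd , yc))) }
        in contradiction
             (unique-length
               ((t≢y₁ ∷ t≢y₂ ∷ t≢z₁ ∷ t≢z₂ ∷ t≢w₁ ∷ t≢w₂ ∷ [])
               ∷ (y₁≢y₂ ∷ y#z t≢y₁ my₁ mz₁ ∷ y#z t≢y₁ my₁ mz₂ ∷ y#w t≢y₁ my₁ mw₁ ∷ y#w t≢y₁ my₁ mw₂ ∷ [])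
               ∷ (y#z t≢y₂ my₂ mz₁ ∷ y#z t≢y₂ my₂ mz₂ ∷ y#w t≢y₂ my₂ mw₁ ∷ y#w t≢y₂ my₂ mw₂ ∷ [])
               ∷ (z₁≢z₂ ∷ z#w t≢z₁ mz₁ mw₁ ∷ z#w t≢z₁ mz₁ mw₂ ∷ [])
               ∷ (z#w t≢z₂ mz₂ mw₁ ∷ z#w t≢z₂ mz₂ mw₂ ∷ [])
               ∷ (w₁≢w₂ ∷ []) ∷ [] ∷ []))
             ℕ.1+n≰n

    extend-vertex : ∀ {y z w} → Distinct x y z w →
                    AtMost 3 C y → AtMost 3 C z → AtMost 3 C w → ¬ ¬ Extension C x y z w
    extend-vertex {y} {z} {w} distinct y≤3 z≤3 w≤3 none =
      ¬¬-all-dec λ y? → ¬¬-all-dec λ z? → ¬¬-all-dec λ w? → go y? z? w? none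
      where
      open Distinct distinct
      distinct₁ = distinct-rotate distinct
      distinct₂ = distinct-rotate distinct₁
      rotate₁ = extension-rotate {C = C} {x} {y} {z} {w}
      rotate₂ = extension-rotate {C = C} {x} {y} {z} {w} ∘ extension-rotate
      go : Seen? y → Seen? z → Seen? w → ¬ ¬ Extension C x y z w
      go y? z? w? with search? (λ t → ¬? (y? t) ×-dec ¬? (z? t) ×-dec ¬? (w? t))
      ... | yes (t , yt , zt , wt) with second-common distinct y? z? w? y≤3 z≤3 w≤3 t
      ...   | c , c≢t , inj₁ (yc , zc) = contradiction
        (extend-common distinct y? z? w? y≤3 z≤3 w≤3 c≢t yt zt wt yc zc)
      ...   | c , c≢t , inj₂ (inj₁ (zc , wc)) = contradiction
        (rotate₁ (extend-common distinct₁ z? w? y? z≤3 w≤3 y≤3 c≢t zt wt yt zc wc))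
      ...   | c , c≢t , inj₂ (inj₂ (wc , yc)) = contradiction
        (rotate₂ (extend-common distinct₂ w? y? z? w≤3 y≤3 z≤3 c≢t wt yt zt wc yc))
      go y? z? w? | no ¬common
        with search? (λ c → ¬? (y? c) ×-dec ¬? (z? c)) | search? (λ c → ¬? (z? c) ×-dec ¬? (w? c))
           | search? (λ c → ¬? (w? c) ×-dec ¬? (y? c))
      -- The shared colours are distinct because no colour is missed by all three vertices. Each
      -- goes to one vertex of its pair and is missed by the other.
      ... | yes (p , yp , zp) | yes (q , zq , wq) | yes (r , wr , yr) = contradiction
        (extend _≟_ good distinct isolated
          (λ { refl → ¬common (p , yp , zp , wq) }) (λ { refl → ¬common (q , yr , zq , wq) })
          (λ { refl → ¬common (r , yr , zp , wr) }) yp zq wr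
          (missed₂ good y≢z zp) (missed₂ good z≢w wq) (missed₂ good w≢y yr))
      ... | no y#z | _ | _ =
        extend-disjoint distinct y? z? w? y≤3 z≤3 w≤3
          (λ { yc zd refl → y#z (_ , yc , zd) })
      ... | yes _ | no z#w | _ = λ k →
        extend-disjoint distinct₁ z? w? y? z≤3 w≤3 y≤3
          (λ { zc wd refl → z#w (_ , zc , wd) }) (k ∘ rotate₁)
      ... | yes _ | yes _ | no w#y = λ k →
        extend-disjoint distinct₂ w? y? z? w≤3 y≤3 z≤3
          (λ { wc yd refl → w#y (_ , wc , yd) }) (k ∘ rotate₂)

-- Deleting and restoring vertices

length-filter-map : ∀ {A B : Set} {P : B → Set} (P? : Decidable P) (f : A → B) xs →
                    length (filter P? (map f xs)) ≡ length (filter (P? ∘ f) xs)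
length-filter-map P? f [] = refl
length-filter-map P? f (x ∷ xs) with P? (f x)
... | yes _ = cong suc (length-filter-map P? f xs)
... | no _  = length-filter-map P? f xs

length-filter-product : ∀ {A B : Set} {P : A × B → Set} (P? : Decidable P) {k} ys →
  (∀ x → k ≤ length (filter (λ y → P? (x , y)) ys)) →
  ∀ xs → length xs * k ≤ length (filter P? (cartesianProduct xs ys))
length-filter-product P? ys rows [] = z≤n
length-filter-product P? {k} ys rows (x ∷ xs) = begin
  k + length xs * k
    ≤⟨ ℕ.+-mono-≤ (rows x) (length-filter-product P? ys rows xs) ⟩
  length (filter (λ y → P? (x , y)) ys) + length (filter P? (cartesianProduct xs ys))
    ≡⟨ cong (_+ _) (length-filter-map P? (x ,_) ys) ⟨
  length (filter P? (map (x ,_) ys)) + length (filter P? (cartesianProduct xs ys))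
    ≡⟨ length-++ (filter P? (map (x ,_) ys)) ⟨
  length (filter P? (map (x ,_) ys) ++ filter P? (cartesianProduct xs ys))
    ≡⟨ cong length (filter-++ P? (map (x ,_) ys) _) ⟨
  length (filter P? (cartesianProduct (x ∷ xs) ys)) ∎
  where open ℕ.≤-Reasoning

restrict : ∀ {V K : Set} {R : V → V → Set} → (∀ u v → Dec (R u v)) → Colouring V K → Colouring V K
restrict R? C u v with R? u v
... | yes _ = C u v
... | no _  = nothing

module _ {V K : Set} {R : V → V → Set} (R? : ∀ u v → Dec (R u v)) {C : Colouring V K} where

  restrict-⊑ : restrict R? C ⊑ C
  restrict-⊑ {u} {v} e with R? u v
  restrict-⊑ e  | yes _ = e
  restrict-⊑ () | no _

  restrict-sound : ∀ {u v a} → restrict R? C u v ≡ just a → R u v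
  restrict-sound {u} {v} e with R? u v
  restrict-sound e  | yes r = r
  restrict-sound () | no _

  restrict-coloured : ∀ {u v a} → R u v → C u v ≡ just a → restrict R? C u v ≡ just a
  restrict-coloured {u} {v} r e with R? u v
  ... | yes _ = e
  ... | no ¬r = contradiction r ¬r

  restrict-good : (∀ {u v} → R u v → R v u) → Good C → Good (restrict R? C)
  restrict-good R-sym good = good-antimono restrict-⊑
    (λ e → restrict-coloured (R-sym (restrict-sound e)) (Good.symmetric good (restrict-⊑ e))) good

module _ {n : ℕ} (G : SimpleGraph n) where
  open SimpleGraph G
  open import Data.List.Membership.DecPropositional (Fin._≟_ {n}) using (_∈?_)

  neighbours-length : ∀ {v us} → Unique us → All (Adj v) us → length us ≤ degree G v
  neighbours-length {v} us-unique adjs = unique-⊆-length us-unique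
    (λ u∈us → ∈-filter⁺ (adj? v) (∈-allFin _) (All.lookup adjs u∈us))

  degree≤Δ : ∀ v → degree G v ≤ Δ G
  degree≤Δ v = All.lookup (xs≤max 0 (map (degree G) (allFin n))) (∈-map⁺ (degree G) (∈-allFin v))

  -- If all degrees were at least 4, there would be at least 4n ordered adjacent pairs. Each edge
  -- accounts for two, so 4n ≤ 2m ≤ 4n - 2.
  low-degree-vertex : Fin n → size G ≤ 2 * n ∸ 1 → ∃[ v ] degree G v ≤ 3
  low-degree-vertex v m≤2n-1 with Fin.any? (λ v → degree G v ≤? 3)
  ... | yes found = found
  ... | no none   = contradiction (ℕ.≤-trans 4n≤2m 2m≤) (ℕ.<⇒≱ (bound v))
    where
    arcs = filter (λ (u , v) → adj? u v) (cartesianProduct (allFin n) (allFin n))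
    4n≤arcs : length (allFin n) * 4 ≤ length arcs
    4n≤arcs = length-filter-product (λ (u , v) → adj? u v) (allFin n)
      (λ u → ℕ.≰⇒> (λ d → none (u , d))) (allFin n)
    covered : arcs ⊆ edges G ++ map swap (edges G)
    covered {u , v} uv∈ with ∈-filter⁻ (λ (u , v) → adj? u v) {xs = cartesianProduct (allFin n) (allFin n)} uv∈
    ... | _ , uv with Fin.<-cmp u v
    ...   | tri< u<v _ _  = ∈-++⁺ˡ (∈-filter⁺ _ (∈-cartesianProduct⁺ (∈-allFin u) (∈-allFin v)) (u<v , uv))
    ...   | tri≈ _ u≡v _  = contradiction uv (adj-irrefl u≡v)
    ...   | tri> _ _ v<u  = ∈-++⁺ʳ (edges G) (∈-map⁺ swap
      (∈-filter⁺ _ (∈-cartesianProduct⁺ (∈-allFin v) (∈-allFin u)) (v<u , adj-sym uv)))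
    arcs-unique : Unique arcs
    arcs-unique = filter⁺ _ (cartesianProduct⁺ (allFin⁺ n) (allFin⁺ n))
    arcs≤2m : length arcs ≤ size G + size G
    arcs≤2m = ℕ.≤-trans (unique-⊆-length arcs-unique covered)
      (ℕ.≤-reflexive (trans (length-++ (edges G)) (cong (size G +_) (length-map swap (edges G)))))
    4n≤2m : n * 4 ≤ size G + size G
    4n≤2m = subst (λ k → k * 4 ≤ size G + size G) (length-tabulate {n = n} id) (ℕ.≤-trans 4n≤arcs arcs≤2m)
    2m≤ : size G + size G ≤ (2 * n ∸ 1) + (2 * n ∸ 1)
    2m≤ = ℕ.+-mono-≤ m≤2n-1 m≤2n-1
    -- The vertex rules out n = 0, where truncated subtraction would make both sides 0.
    bound : ∀ {n} → Fin n → (2 * n ∸ 1) + (2 * n ∸ 1) < n * 4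
    bound {suc n} _ = ℕ.≤-trans (s≤s (ℕ.+-monoʳ-≤ (2 * suc n ∸ 1) (ℕ.m∸n≤m (2 * suc n) 1)))
      (ℕ.≤-reflexive (trans (sym (ℕ.*-distribʳ-+ (suc n) 2 2)) (ℕ.*-comm 4 (suc n))))

  -- The three spare vertices stand in for missing neighbours, so that
  -- every vertex to be coloured has exactly three.
  V : Set
  V = Fin n ⊎ Fin 3

  _≟ⱽ_ : DecidableEquality V
  _≟ⱽ_ = ≡-dec Fin._≟_ Fin._≟_

  -- `D` lists the deleted vertices; the spare ones carry no edges.
  Edge : List (Fin n) → V → V → Set
  Edge D (inj₁ u) (inj₁ v) = Adj u v × u ∉ D × v ∉ D
  Edge D _        _        = ⊥

  edge? : ∀ D u v → Dec (Edge D u v)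
  edge? D (inj₁ u) (inj₁ v) = adj? u v ×-dec ¬? (u ∈? D) ×-dec ¬? (v ∈? D)
  edge? D (inj₁ _) (inj₂ _) = no λ ()
  edge? D (inj₂ _) _        = no λ ()

  edge-sym : ∀ {D} u v → Edge D u v → Edge D v u
  edge-sym (inj₁ u) (inj₁ v) (uv , u∉D , v∉D) = adj-sym uv , v∉D , u∉D

  record ColouringOutside (D : List (Fin n)) : Set where
    field
      colouring : Colouring V (Fin 6)
      good      : Good colouring
      sound     : ∀ u v {a} → colouring u v ≡ just a → Edge D u v
      complete  : ∀ u v → Edge D u v → Coloured colouring u v

  module _ (≤4 : ∀ v → degree G v ≤ 4) where

    few-outside : ∀ {x y D us} → Adj x y → y ∈ D → Unique us → All (λ u → Adj x u × u ∉ D) us →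
                  length us ≤ 3
    few-outside {us = us} xy y∈D us-unique adjs = ℕ.≤-pred (ℕ.≤-trans
      (neighbours-length (¬Any⇒All¬ us (λ y∈us → proj₂ (All.lookup adjs y∈us) y∈D) ∷ us-unique)
                         (xy ∷ All.map proj₁ adjs))
      (≤4 _))

    module _ {D : List (Fin n)} (colours : ColouringOutside D) where
      open ColouringOutside colours renaming (colouring to C)

      -- Distinct colours are seen along distinct edges, which turns degree bounds into bounds on
      -- seen colours.
      seen-neighbours : ∀ {v cs} → Unique cs → All (Sees C (inj₁ v)) cs →
        ∃[ us ] Unique us × length us ≡ length cs ×
                All (λ u → (Adj v u × u ∉ D) × ∃[ c ] c ∈ cs × C (inj₁ v) (inj₁ u) ≡ just c) us
      seen-neighbours [] [] = [] , [] , refl , []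
      seen-neighbours {v} (c∉cs ∷ cs-unique) ((inj₁ u , e) ∷ seen)
        with seen-neighbours cs-unique seen
      ... | us , us-unique , ∣us∣ , adjs =
        u ∷ us , ¬Any⇒All¬ us u∉us ∷ us-unique , cong suc ∣us∣ ,
        (outside , _ , here refl , e) ∷
        All.map (λ (o , c , c∈cs , f) → o , c , there c∈cs , f) adjs
        where
        outside : Adj v u × u ∉ D
        outside = let vu , _ , u∉D = sound (inj₁ v) (inj₁ u) e in vu , u∉D
        u∉us : u ∉ us
        u∉us u∈us with All.lookup adjs u∈us
        ... | _ , c , c∈cs , f = All.lookup c∉cs c∈cs (just-injective (trans (sym e) f))
      seen-neighbours {v} _ ((inj₂ i , e) ∷ _) = ⊥-elim (sound (inj₁ v) (inj₂ i) e)

      spare-at-most : ∀ {k} i → AtMost k C (inj₂ i)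
      spare-at-most i []      _ _                = z≤n
      spare-at-most i (_ ∷ _) _ ((u , e) ∷ _)    = ⊥-elim (sound (inj₂ i) u e)

      at-most-4 : ∀ v → AtMost 4 C v
      at-most-4 (inj₂ i) = spare-at-most i
      at-most-4 (inj₁ v) cs cs-unique seen with seen-neighbours cs-unique seen
      ... | us , us-unique , ∣us∣ , adjs = subst (_≤ 4) ∣us∣
        (ℕ.≤-trans (neighbours-length us-unique (All.map (proj₁ ∘ proj₁) adjs)) (≤4 v))

      at-most-3 : ∀ {v y} → Adj v y → y ∈ D → AtMost 3 C (inj₁ v)
      at-most-3 vy y∈D cs cs-unique seen with seen-neighbours cs-unique seen
      ... | us , us-unique , ∣us∣ , adjs = subst (_≤ 3) ∣us∣
        (few-outside vy y∈D us-unique (All.map proj₁ adjs))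

    module _ {D : List (Fin n)} {x : Fin n}
             (few : ∀ us → Unique us → All (λ u → Adj x u × u ∉ D) us → length us ≤ 3)
             (colours : ColouringOutside (x ∷ D)) where
      open ColouringOutside colours renaming (colouring to C)

      private
        Slot : V → Set
        Slot (inj₁ u) = Adj x u × u ∉ D
        Slot (inj₂ _) = ⊤

        slot-distinct : ∀ v → Slot v → inj₁ x ≢ v
        slot-distinct (inj₁ u) (xu , _) refl = adj-irrefl refl xu

        slot-at-most-3 : ∀ v → Slot v → AtMost 3 C v
        slot-at-most-3 (inj₁ u) (xu , _) = at-most-3 colours (adj-sym xu) (here refl)
        slot-at-most-3 (inj₂ i) _        = spare-at-most colours i

        record Slots : Set where
          field
            {y z w}  : V
            y-slot   : Slot y
            z-slot   : Slot z
            w-slot   : Slot w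
            y≢z      : y ≢ z
            z≢w      : z ≢ w
            w≢y      : w ≢ y
            complete : ∀ {u} → Adj x u → u ∉ D → inj₁ u ≡ y ⊎ inj₁ u ≡ z ⊎ inj₁ u ≡ w

        slots : Slots
        slots = pad (filter outside? (allFin n)) (filter⁺ outside? (allFin⁺ n))
                    (all-filter outside? (allFin n))
                    (λ xu u∉D → ∈-filter⁺ outside? (∈-allFin _) (xu , u∉D))
          where
          outside? = λ u → adj? x u ×-dec ¬? (u ∈? D)
          inj₁-≢ : ∀ {u v : Fin n} → u ≢ v → inj₁ {B = Fin 3} u ≢ inj₁ v
          inj₁-≢ u≢v refl = u≢v refl
          pad : ∀ us → Unique us → All (λ u → Adj x u × u ∉ D) us →
                (∀ {u} → Adj x u → u ∉ D → u ∈ us) → Slots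
          pad [] _ _ ∈us = record
            { y = inj₂ zero ; z = inj₂ (suc zero) ; w = inj₂ (suc (suc zero))
            ; y-slot = _ ; z-slot = _ ; w-slot = _ ; y≢z = λ () ; z≢w = λ () ; w≢y = λ ()
            ; complete = λ xu u∉D → contradiction (∈us xu u∉D) λ () }
          pad (y ∷ []) _ (y-slot ∷ []) ∈us = record
            { y = inj₁ y ; z = inj₂ (suc zero) ; w = inj₂ (suc (suc zero))
            ; y-slot = y-slot ; z-slot = _ ; w-slot = _ ; y≢z = λ () ; z≢w = λ () ; w≢y = λ ()
            ; complete = λ xu u∉D → case₁ (∈us xu u∉D) }
            where
            case₁ : ∀ {u} → u ∈ y ∷ [] → _
            case₁ (here refl) = inj₁ refl
          pad (y ∷ z ∷ []) ((y≢z ∷ []) ∷ _) (y-slot ∷ z-slot ∷ []) ∈us = record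
            { y = inj₁ y ; z = inj₁ z ; w = inj₂ (suc (suc zero))
            ; y-slot = y-slot ; z-slot = z-slot ; w-slot = _
            ; y≢z = inj₁-≢ y≢z ; z≢w = λ () ; w≢y = λ ()
            ; complete = λ xu u∉D → case₂ (∈us xu u∉D) }
            where
            case₂ : ∀ {u} → u ∈ y ∷ z ∷ [] → _
            case₂ (here refl)         = inj₁ refl
            case₂ (there (here refl)) = inj₂ (inj₁ refl)
          pad (y ∷ z ∷ w ∷ []) ((y≢z ∷ y≢w ∷ []) ∷ (z≢w ∷ []) ∷ _) (y-slot ∷ z-slot ∷ w-slot ∷ []) ∈us = record
            { y = inj₁ y ; z = inj₁ z ; w = inj₁ w
            ; y-slot = y-slot ; z-slot = z-slot ; w-slot = w-slot
            ; y≢z = inj₁-≢ y≢z ; z≢w = inj₁-≢ z≢w ; w≢y = inj₁-≢ (≢-sym y≢w)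
            ; complete = λ xu u∉D → case₃ (∈us xu u∉D) }
            where
            case₃ : ∀ {u} → u ∈ y ∷ z ∷ w ∷ [] → _
            case₃ (here refl)                 = inj₁ refl
            case₃ (there (here refl))         = inj₂ (inj₁ refl)
            case₃ (there (there (here refl))) = inj₂ (inj₂ refl)
          pad us@(_ ∷ _ ∷ _ ∷ _ ∷ _) us-unique adjs _ =
            contradiction (few us us-unique adjs) λ { (s≤s (s≤s (s≤s ()))) }

      restore-vertex : ¬ ¬ ColouringOutside D
      restore-vertex none = extend-vertex _≟ⱽ_ good isolated (at-most-4 colours) distinct
        (slot-at-most-3 _ y-slot) (slot-at-most-3 _ z-slot) (slot-at-most-3 _ w-slot)
        (none ∘ restricted)
        where
        open Slots slots renaming (complete to slots-complete)
        isolated : Isolated C (inj₁ x)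
        isolated (inj₁ u , e) = let _ , x∉ , _ = sound (inj₁ x) (inj₁ u) e in x∉ (here refl)
        isolated (inj₂ i , e) = sound (inj₁ x) (inj₂ i) e
        distinct : Distinct (inj₁ x) y z w
        distinct = record
          { x≢y = slot-distinct _ y-slot ; x≢z = slot-distinct _ z-slot ; x≢w = slot-distinct _ w-slot
          ; y≢z = y≢z ; z≢w = z≢w ; w≢y = w≢y }
        restricted : Extension C (inj₁ x) y z w → ColouringOutside D
        restricted extension = record
          -- The extension may also colour edges from `x` to spare vertices; these are dropped.
          { colouring = restrict (edge? D) C′
          ; good      = restrict-good (edge? D) (λ {u} {v} → edge-sym u v) good′
          ; sound     = λ u v → restrict-sound (edge? D)
          ; complete  = λ u v uv → let a , e = coloured u v uv in a , restrict-coloured (edge? D) uv e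
          }
          where
          open Extension extension renaming (colouring to C′; good to good′)
          at-x : ∀ u → Edge D (inj₁ x) u → Coloured C′ (inj₁ x) u
          at-x (inj₁ u) (xu , _ , u∉D) with slots-complete xu u∉D
          ... | inj₁ u≡y        = subst (Coloured C′ _) (sym u≡y) xy
          ... | inj₂ (inj₁ u≡z) = subst (Coloured C′ _) (sym u≡z) xz
          ... | inj₂ (inj₂ u≡w) = subst (Coloured C′ _) (sym u≡w) xw
          ∉-∷ : ∀ {u} → u ≢ x → u ∉ D → u ∉ x ∷ D
          ∉-∷ u≢x u∉D (here u≡x)  = u≢x u≡x
          ∉-∷ u≢x u∉D (there u∈D) = u∉D u∈D
          coloured : ∀ u v → Edge D u v → Coloured C′ u v
          coloured (inj₁ u) (inj₁ v) uv@(adj , u∉D , v∉D) with u Fin.≟ x | v Fin.≟ x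
          ... | yes refl | _        = at-x (inj₁ v) uv
          ... | no _     | yes refl =
            let a , e = at-x (inj₁ u) (edge-sym (inj₁ u) (inj₁ x) uv) in a , Good.symmetric good′ e
          ... | no u≢x   | no v≢x   =
            support (complete (inj₁ u) (inj₁ v) (adj , ∉-∷ u≢x u∉D , ∉-∷ v≢x v∉D))

    module _ (connected : ∀ u v → Walk G u v) {root : Fin n} (root≤3 : degree G root ≤ 3) where

      crossing : ∀ {u v D} → Walk G u v → u ∉ D → v ∈ D → ∃[ x ] ∃[ y ] Adj x y × x ∉ D × y ∈ D
      crossing ε u∉D v∈D = contradiction v∈D u∉D
      crossing {D = D} (_◅_ {j = w} uw p) u∉D v∈D with w ∈? D
      ... | yes w∈D = _ , w , uw , u∉D , w∈D
      ... | no w∉D  = crossing p w∉D v∈D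

      -- Deletion starts at a vertex of degree at most 3. Afterwards a walk into `D` always yields a
      -- vertex outside with a neighbour inside, and that neighbour is one of its at most four.
      next-vertex : ∀ {v} D → v ∉ D → ∃[ x ] x ∉ D ×
                    (∀ us → Unique us → All (λ u → Adj x u × u ∉ D) us → length us ≤ 3)
      next-vertex [] _ = root , (λ ()) , λ us us-unique adjs →
        ℕ.≤-trans (neighbours-length us-unique (All.map proj₁ adjs)) root≤3
      next-vertex (d ∷ D) v∉D =
        let x , y , xy , x∉D , y∈D = crossing (connected _ d) v∉D (here refl)
        in x , x∉D , λ us us-unique adjs → few-outside xy y∈D us-unique adjs

      -- `k` bounds the number of vertices still present. The recursion deletes `x`, colours what is
      -- left and restores `x`.
      colour-outside : ∀ k D → Unique D → n ≤ length D + k → ¬ ¬ ColouringOutside D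
      colour-outside k D D-unique bound none with Fin.any? (λ v → ¬? (v ∈? D))
      ... | no covered = none (record
        { colouring = λ _ _ → nothing
        ; good = record { symmetric = λ () ; irreflexive = λ () ; proper = λ ()
                        ; acyclic = λ { _ (along ()) } }
        ; sound    = λ _ _ ()
        ; complete = λ { (inj₁ u) (inj₁ v) (_ , u∉D , _) → contradiction (u , u∉D) covered } })
      ... | yes (v , v∉D) with next-vertex D v∉D
      ...   | x , x∉D , few with k | ¬Any⇒All¬ D x∉D ∷ D-unique
      ...     | zero  | xD-unique = contradiction (unique-length xD-unique)
        (ℕ.<⇒≱ (s≤s (subst (n ≤_) (ℕ.+-identityʳ (length D)) bound)))
      ...     | suc k | xD-unique =
        colour-outside k (x ∷ D) xD-unique (subst (n ≤_) (ℕ.+-suc (length D) k) bound)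
          λ colours → restore-vertex few colours none

      colour-all : ¬ ¬ ColouringOutside []
      colour-all = colour-outside n [] [] ℕ.≤-refl

-- Edge colourings of the graph, and their decidability

module _ {n : ℕ} (G : SimpleGraph n) where
  open SimpleGraph G

  module _ (colours : ColouringOutside G []) where
    open ColouringOutside colours renaming (colouring to C)
    open Good good renaming (proper to C-proper; acyclic to C-acyclic)

    private
      coloured : ∀ {u v} → Adj u v → Coloured C (inj₁ u) (inj₁ v)
      coloured {u} {v} uv = complete (inj₁ u) (inj₁ v) (uv , (λ ()) , (λ ()))

      colour′ : ∀ u v → Adj u v → Fin 6
      colour′ _ _ uv = proj₁ (coloured uv)

      edge : ∀ {u v} (uv : Adj u v) → C (inj₁ u) (inj₁ v) ≡ just (colour′ u v uv)
      edge uv = proj₂ (coloured uv)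

    edgeColouring : EdgeColouring G 6
    edgeColouring = record
      { colour     = colour′
      ; colour-sym = λ u v e f → just-injective (trans (sym (symmetric (edge e))) (edge f))
      }

    edgeColouring-proper : Proper G edgeColouring
    edgeColouring-proper u v w e f v≢w same =
      v≢w (inj₁-injective (C-proper (edge e) (trans (edge f) (cong just (sym same)))))

    private
      OneOf : Fin 6 → Fin 6 → Fin 6 → Set
      OneOf a b c = c ≡ a ⊎ c ≡ b

      next≢ : ∀ {v w t u} (vw : Adj v w) (p : Walk G w t) → u ≢ t →
              All (u ≢_) (vertices G (vw ◅ p)) → u ≢ w
      next≢ vw ε       u≢t _             = u≢t
      next≢ vw (_ ◅ _) _   (_ ∷ u≢w ∷ _) = u≢w

      second-colour : ∀ {u v w b c} (uv : Adj u v) (vw : Adj v w) → colour′ u v uv ≡ c → u ≢ w →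
                      OneOf b c (colour′ v w vw) → colour′ v w vw ≡ b
      second-colour uv vw _    _   (inj₁ ≡b) = ≡b
      second-colour uv vw refl u≢w (inj₂ ≡c) = contradiction
        (trans (EdgeColouring.colour-sym edgeColouring _ _ (adj-sym uv) uv) (sym ≡c))
        (edgeColouring-proper _ _ _ (adj-sym uv) vw u≢w)

      -- The last edge is kept so that its colour at the closing vertex can be compared with that of
      -- the first edge.
      record Closing (u : Fin n) {v t} (p : Walk G v t) (b c : Fin 6) : Set where
        field
          {b′ c′}   : Fin 6
          {last}    : Fin n
          walk      : Alternating C (inj₁ v , b , c) (inj₁ t , b′ , c′)
          last∈     : last ∈ u ∷ vertices G p
          last-edge : C (inj₁ last) (inj₁ t) ≡ just c′

      -- A walk that never turns back and uses two colours alternates between them.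
      closing : ∀ {u v t b c} (uv : Adj u v) (p : Walk G v t) → colour′ u v uv ≡ c →
                All (_≢ t) (u ∷ vertices G p) → Unique (u ∷ vertices G p) →
                All (OneOf b c) (Defs.colours G edgeColouring p) → Closing u p b c
      closing uv ε ≡c _ _ _ = record
        { walk = ε ; last∈ = here refl ; last-edge = trans (edge uv) (cong just ≡c) }
      closing uv (vw ◅ p) ≡c (u≢t ∷ ≢t) (u∉ ∷ unique) (one ∷ ones) = record
        { walk      = along (trans (edge vw) (cong just ≡b)) ◅ walk
        ; last∈     = there last∈
        ; last-edge = last-edge
        } where
        ≡b = second-colour uv vw ≡c (next≢ vw p u≢t u∉) one
        open Closing (closing vw p ≡b ≢t unique (All.map Sum.swap ones))

    edgeColouring-acyclic : Acyclic G edgeColouring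
    edgeColouring-acyclic t ε               (()             , _)
    edgeColouring-acyclic t (_ ◅ ε)         (s≤s ()         , _)
    edgeColouring-acyclic t (_ ◅ _ ◅ ε)     (s≤s (s≤s ())   , _)
    edgeColouring-acyclic t (_◅_ {j = u₁} e₁ (_◅_ {j = u₂} e₂ (_◅_ {j = u₃} e₃ p)))
      (_ , ((t≢u₁ ∷ t≢u₂ ∷ t∉p) ∷ (u₁≢u₂ ∷ u₁∉p) ∷ unique)) (a , b , one₁ ∷ one₂ ∷ one₃ ∷ ones) =
      C-acyclic c₁≢c₂ (along (edge e₁))
        (along (edge e₂) ◅ along (trans (edge e₃) (cong just ≡c₁)) ◅
         subst₂ (λ b c → Alternating C (inj₁ u₃ , c₂ , c₁) (inj₁ t , b , c)) (proj₁ end) (proj₂ end) walk)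
      where
      c₁ = colour′ t u₁ e₁
      c₂ = colour′ u₁ u₂ e₂
      c₁≢c₂ : c₁ ≢ c₂
      c₁≢c₂ same = edgeColouring-proper _ _ _ (adj-sym e₁) e₂ t≢u₂
        (trans (EdgeColouring.colour-sym edgeColouring _ _ (adj-sym e₁) e₁) same)
      only : ∀ {c} → OneOf a b c → OneOf c₁ c₂ c
      only = narrow c₁≢c₂ one₁ one₂
        where
        narrow : ∀ {a b c₁ c₂ c} → c₁ ≢ c₂ → OneOf a b c₁ → OneOf a b c₂ → OneOf a b c → OneOf c₁ c₂ c
        narrow c₁≢c₂ (inj₁ refl) (inj₁ refl) _   = contradiction refl c₁≢c₂
        narrow c₁≢c₂ (inj₁ refl) (inj₂ refl) one = one
        narrow c₁≢c₂ (inj₂ refl) (inj₁ refl) one = Sum.swap one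
        narrow c₁≢c₂ (inj₂ refl) (inj₂ refl) _   = contradiction refl c₁≢c₂
      ≡c₁ = second-colour e₂ e₃ refl (next≢ e₃ p (≢-sym t≢u₁) (u₁≢u₂ ∷ u₁∉p)) (only one₃)
      open Closing (closing e₃ p ≡c₁ (All.map ≢-sym (t≢u₂ ∷ t∉p)) unique
                            (All.map (Sum.swap ∘ only) ones))
      -- If the last edge had colour `c₁`, as in an odd cycle, properness at `t` would make its
      -- other end `u₁`, which does not recur.
      end : b′ ≡ c₁ × c′ ≡ c₂
      end with alternating-colours walk
      ... | inj₂ eqs = eqs
      ... | inj₁ (_ , c′≡c₁) = contradiction
        (inj₁-injective (C-proper (edge e₁) (trans (symmetric last-edge) (cong just c′≡c₁))))
        (All.lookup (u₁≢u₂ ∷ u₁∉p) last∈)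

  ≤4⇒¬¬colourable : Connected G → size G ≤ 2 * n ∸ 1 → Δ G ≤ 4 → ¬ ¬ AcyclicEdgeColourable G 6
  ≤4⇒¬¬colourable (v , connected) m≤2n-1 Δ≤4 none =
    let _ , root≤3 = low-degree-vertex G v m≤2n-1
    in colour-all G (λ u → ℕ.≤-trans (degree≤Δ G u) Δ≤4) connected root≤3 λ colours →
       none (edgeColouring colours , edgeColouring-proper colours , edgeColouring-acyclic colours)

  -- Deciding colourability by finite search

  module _ {k : ℕ} where

    module _ (c : EdgeColouring G k) where
      open EdgeColouring c

      colour-irrelevant : ∀ {u v} (e f : Adj u v) → colour u v e ≡ colour u v f
      colour-irrelevant e f = trans (colour-sym _ _ e (adj-sym e)) (sym (colour-sym _ _ f (adj-sym e)))

      adj-all? : ∀ {u v} {P : Adj u v → Set} → (∀ e → Dec (P e)) → (∀ {e f} → P e → P f) →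
                 Dec (∀ e → P e)
      adj-all? {u} {v} P? resp with adj? u v
      ... | no ¬e = yes λ e → contradiction e ¬e
      ... | yes e = map′ (λ p _ → resp p) (λ p → p e) (P? e)

      proper? : Dec (Proper G c)
      proper? = Fin.all? λ u → Fin.all? λ v → Fin.all? λ w →
        adj-all? (λ e → adj-all? (λ f → ¬? (v Fin.≟ w) →-dec ¬? (colour u v e Fin.≟ colour u w f))
                                 (λ p v≢w same → p v≢w (trans same (colour-irrelevant _ _))))
                 (λ p f v≢w same → p f v≢w (trans (colour-irrelevant _ _) same))

      -- `Q` speaks of the lists of vertices and colours, not of the walk, so the recursion can
      -- prepend the first entries. It also makes the choice of adjacency proofs immaterial.
      walk? : ∀ ℓ {Q : List (Fin n) → List (Fin k) → Set} → (∀ vs cs → Dec (Q vs cs)) → ∀ u v →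
              Dec (∃[ p ] length (vertices G {u} {v} p) ≡ ℓ × Q (vertices G p) (colours G c p))
      walk? zero Q? u v with u Fin.≟ v
      ... | no u≢v   = no λ { (ε , _) → u≢v refl ; (_ ◅ _ , () , _) }
      ... | yes refl = map′ (λ q → ε , refl , q) (λ { (ε , _ , q) → q ; (_ ◅ _ , () , _) }) (Q? [] [])
      walk? (suc ℓ) {Q} Q? u v = map′
        (λ (w , e , p , ∣p∣ , q) → e ◅ p , cong suc ∣p∣ , q)
        (λ { (ε , () , _) ; (e ◅ p , ∣p∣ , q) → _ , e , p , ℕ.suc-injective ∣p∣ , q })
        (Fin.any? first?)
        where
        First : Fin n → Set
        First w = Σ (Adj u w) λ e → ∃[ p ] length (vertices G {w} {v} p) ≡ ℓ ×
                  Q (u ∷ vertices G p) (colour u w e ∷ colours G c p)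
        first? : ∀ w → Dec (First w)
        first? w with adj? u w
        ... | no ¬e = no λ (e , _) → ¬e e
        ... | yes e = map′ (e ,_)
          (λ (f , p , ∣p∣ , q) → p , ∣p∣ ,
            subst (λ a → Q (u ∷ vertices G p) (a ∷ colours G c p)) (colour-irrelevant f e) q)
          (walk? ℓ (λ vs cs → Q? (u ∷ vs) (colour u w e ∷ cs)) w v)

      BichromaticCycle : List (Fin n) → List (Fin k) → Set
      BichromaticCycle vs cs =
        (3 ≤ length vs × Unique vs) × ∃[ a ] ∃[ b ] All (λ x → x ≡ a ⊎ x ≡ b) cs

      bichromaticCycle? : ∀ vs cs → Dec (BichromaticCycle vs cs)
      bichromaticCycle? vs cs = (3 ≤? length vs ×-dec unique? vs) ×-dec
        Fin.any? λ a → Fin.any? λ b → All.all? (λ x → x Fin.≟ a ⊎-dec x Fin.≟ b) cs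
        where open import Data.List.Relation.Unary.Unique.DecPropositional (Fin._≟_ {n}) using (unique?)

      -- A cycle has distinct vertices, so its length is at most n and ranges over `Fin (suc n)`.
      HasBichromaticCycle : Set
      HasBichromaticCycle = ∃[ v ] Σ (Fin (suc n)) λ ℓ → ∃[ p ]
        length (vertices G {v} {v} p) ≡ toℕ ℓ × BichromaticCycle (vertices G p) (colours G c p)

      acyclic? : Dec (Acyclic G c)
      acyclic? = map′ {A = ¬ HasBichromaticCycle}
        (λ none v p cycle bichromatic → none (v ,
          fromℕ< (s≤s (unique-length (proj₂ cycle))) , p ,
          sym (Fin.toℕ-fromℕ< (s≤s (unique-length (proj₂ cycle)))) , cycle , bichromatic))
        (λ acyclic (v , _ , p , _ , cycle , bichromatic) → acyclic v p cycle bichromatic)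
        (¬? cycle?)
        where
        cycle? : Dec HasBichromaticCycle
        cycle? = Fin.any? λ v → Fin.any? λ ℓ → walk? (toℕ ℓ) bichromaticCycle? v v

    infix 4 _≈_
    _≈_ : EdgeColouring G k → EdgeColouring G k → Set
    c ≈ d = ∀ {u v} e → EdgeColouring.colour c u v e ≡ EdgeColouring.colour d u v e

    ≈-proper : ∀ {c d} → c ≈ d → Proper G c → Proper G d
    ≈-proper c≈d proper u v w e f v≢w same =
      proper u v w e f v≢w (trans (c≈d e) (trans same (sym (c≈d f))))

    ≈-colours : ∀ {c d} → c ≈ d → ∀ {u v} (p : Walk G u v) → colours G c p ≡ colours G d p
    ≈-colours c≈d ε       = refl
    ≈-colours c≈d (e ◅ p) = cong₂ _∷_ (c≈d e) (≈-colours c≈d p)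

    ≈-acyclic : ∀ {c d} → c ≈ d → Acyclic G c → Acyclic G d
    ≈-acyclic c≈d acyclic v p cycle (a , b , all) =
      acyclic v p cycle (a , b , subst (All _) (sym (≈-colours c≈d p)) all)

    -- Colourings as matrices, in which only the entries at edges matter and
    -- 0 is not a colour, so that matrices exist even for k = 0.
    Matrix : Set
    Matrix = Fin n → Fin n → Fin (suc k)

    _Encodes_ : Matrix → EdgeColouring G k → Set
    M Encodes c = ∀ u v e → M u v ≡ suc (EdgeColouring.colour c u v e)

    encodes-unique : ∀ {M c d} → M Encodes c → M Encodes d → c ≈ d
    encodes-unique Mc Md e = Fin.suc-injective (trans (sym (Mc _ _ e)) (Md _ _ e))

    encode : ∀ c → ∃[ M ] M Encodes c
    encode c = M , encodes
      where
      M : Matrix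
      M u v with adj? u v
      ... | yes e = suc (EdgeColouring.colour c u v e)
      ... | no _  = zero
      encodes : M Encodes c
      encodes u v e with adj? u v
      ... | yes f = cong suc (colour-irrelevant c f e)
      ... | no ¬e = contradiction e ¬e

    Valid : Matrix → Set
    Valid M = ∀ u v → Adj u v → M u v ≡ M v u × M u v ≢ zero

    valid? : ∀ M → Dec (Valid M)
    valid? M = Fin.all? λ u → Fin.all? λ v →
      adj? u v →-dec (M u v Fin.≟ M v u ×-dec ¬? (M u v Fin.≟ zero))

    encodes⇒valid : ∀ {M c} → M Encodes c → Valid M
    encodes⇒valid {M} {c} Mc u v e =
      trans (Mc u v e) (trans (cong suc (EdgeColouring.colour-sym c u v e (adj-sym e))) (sym (Mc v u _))) ,
      λ zero≡ → contradiction (trans (sym zero≡) (Mc u v e)) λ ()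

    decode : ∀ {M} → Valid M → ∃[ c ] M Encodes c
    decode {M} valid = c , λ u v e → proj₂ (entry e)
      where
      nonzero : (i : Fin (suc k)) → i ≢ zero → ∃[ j ] i ≡ suc j
      nonzero zero    i≢0 = contradiction refl i≢0
      nonzero (suc j) _   = j , refl
      entry : ∀ {u v} → Adj u v → ∃[ j ] M u v ≡ suc j
      entry {u} {v} e = nonzero (M u v) (proj₂ (valid u v e))
      c : EdgeColouring G k
      c = record
        { colour     = λ u v e → proj₁ (entry e)
        ; colour-sym = λ u v e f → Fin.suc-injective
            (trans (sym (proj₂ (entry e))) (trans (proj₁ (valid u v e)) (proj₂ (entry f))))
        }

    EncodesAcyclic : Matrix → Set
    EncodesAcyclic M = ∃[ c ] M Encodes c × Proper G c × Acyclic G c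

    encodesAcyclic? : ∀ M → Dec (EncodesAcyclic M)
    encodesAcyclic? M with valid? M
    ... | no invalid = no λ (c , Mc , _) → invalid (encodes⇒valid {c = c} Mc)
    ... | yes valid = map′
      (λ (proper , acyclic) → c , Mc , proper , acyclic)
      (λ (d , Md , proper , acyclic) →
        ≈-proper {d} {c} (encodes-unique {M} {d} {c} Md Mc) proper ,
        ≈-acyclic {d} {c} (encodes-unique {M} {d} {c} Md Mc) acyclic)
      (proper? c ×-dec acyclic? c)
      where
      c  = proj₁ (decode valid)
      Mc = proj₂ (decode valid)

  -- Numbering the matrices by one `Fin` reduces the search over functions to a search over numbers.
  -- The numbering is inverted only pointwise, which suffices since encoding is a pointwise
  -- condition.
  acyclicEdgeColourable? : ∀ k → Dec (AcyclicEdgeColourable G k)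
  acyclicEdgeColourable? k = map′
    (λ (_ , c , _ , good) → c , good)
    (λ (c , good) → let M , Mc = encode c in
      funToFin (funToFin ∘ M) , c ,
      (λ u v e → trans (decoded M u v) (Mc u v e)) , good)
    (Fin.any? (encodesAcyclic? ∘ matrix))
    where
    matrix : Fin ((suc k ^ n) ^ n) → Matrix
    matrix i u = finToFun (finToFun i u)
    decoded : ∀ M u v → matrix (funToFin (funToFin ∘ M)) u v ≡ M u v
    decoded M u v = trans (cong (λ i → finToFun i v) (Fin.finToFun-funToFin (funToFin ∘ M) u))
                          (Fin.finToFun-funToFin (M u) v)

least-below : ∀ {P : ℕ → Set} → (∀ k → Dec (P k)) → ∀ m →
              (∃[ a ] (P a × (∀ k → P k → a ≤ k)) × a < m) ⊎ (∀ k → k < m → ¬ P k)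
least-below P? zero = inj₂ λ _ ()
least-below {P} P? (suc m) with least-below P? m
... | inj₁ (a , least , a<m) = inj₁ (a , least , ℕ.m<n⇒m<1+n a<m)
... | inj₂ none with P? m
...   | yes p = inj₁ (m , (p , λ k pk → ℕ.≮⇒≥ (λ k<m → none k k<m pk)) , ℕ.n<1+n m)
...   | no ¬p = inj₂ λ k k<1+m pk →
  [ (λ k<m → none k k<m pk) , (λ k≡m → ¬p (subst P k≡m pk)) ]′ (ℕ.m<1+n⇒m<n∨m≡n k<1+m)

theorem1 : (n : ℕ) (G : SimpleGraph n) → Connected G → size G ≤ 2 * n ∸ 1 → Δ G ≤ 4 →
    ∃[ a ] (IsAcyclicChromaticIndex G a × a ≤ 6)
-- Below 7 means at most 6. The other outcome refutes colourability with 6 colours, which the doubly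
-- negated result contradicts.
theorem1 n G connected m≤2n-1 Δ≤4 with least-below (acyclicEdgeColourable? G) 7
... | inj₁ (a , least , s≤s a≤6) = a , least , a≤6
... | inj₂ none = contradiction (none 6 ℕ.≤-refl) (≤4⇒¬¬colourable G connected m≤2n-1 Δ≤4)
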